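{- Let $A$ be a twisted axis-aligned $2n$-gon with $A_{i+2n}=\phi(A_i)$ for all $i$, where the projective transformation $\phi$ fixes every point at infinity. Assume $A$ is generic in the sense that $T^{n-1}(A)$ is defined and no three consecutive vertices of $T^{n-1}(A)$ are collinear. Then, writing $B=T^{n-1}(A)$, for each index $i_0$ of $B$ the vertices $B_{i_0+2m}$ ($m\in\mathbb{Z}$) all lie on one line; that is, the odd vertices of $B$ are collinear, as are its even vertices.
   Context: A twisted polygon is a sequence $(A_i)$ of points of the real projective plane, indexed by $\mathbb{Z}$ or $\frac12+\mathbb{Z}$, with $A_{i+N}=\phi(A_i)$ for a projective transformation $\phi$. $A$ (indexed by $\mathbb{Z}$) is axis-aligned if its points lie in the affine plane $\mathbb{R}^2\subset\mathbb{RP}^2$ and its sides $A_iA_{i+1}$ are alternately parallel to the $x$-axis and the $y$-axis. The pentagram map sends $A$ to $B=T(A)$, indexed by the other coset, with $B_i=\overleftrightarrow{A_{i-3/2}A_{i+1/2}}\cap\overleftrightarrow{A_{i-1/2}A_{i+3/2}}$ ($\overleftrightarrow{PQ}$ the line through $P,Q$); $T^{k}$ is the $k$-fold iterate. -}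

module Defs where

open import Level using (0ℓ)
open import Data.Nat using (ℕ; zero; suc) renaming (_≤_ to _≤ℕ_)
open import Data.Integer as ℤ using (ℤ)
open import Data.Product using (Σ; ∃; _×_; _,_)
open import Relation.Binary.PropositionalEquality using (_≡_)
open import Relation.Binary.Structures using (IsTotalOrder)
open import Relation.Nullary using (¬_)
open import Algebra.Structures using (IsCommutativeRing)

record RealField : Set₁ where
  infixl 6 _+_ _-_
  infixl 7 _*_
  infix 4 _≤_
  field
    Carrier : Set
    _+_ _*_ : Carrier → Carrier → Carrier
    -_      : Carrier → Carrier
    0# 1#   : Carrier
    _≤_     : Carrier → Carrier → Set
    isCommutativeRing : IsCommutativeRing _≡_ _+_ _*_ -_ 0# 1#
    0≢1     : ¬ (0# ≡ 1#)
    inverse : ∀ x → ¬ (x ≡ 0#) → ∃ λ y → x * y ≡ 1#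
    isTotalOrder : IsTotalOrder _≡_ _≤_
    +-mono-≤ : ∀ x y z → x ≤ y → x + z ≤ y + z
    *-nonneg : ∀ x y → 0# ≤ x → 0# ≤ y → 0# ≤ x * y
    completeness : (S : Carrier → Set) → (∃ λ x → S x) →
                   (∃ λ b → ∀ x → S x → x ≤ b) →
                   ∃ λ s → (∀ x → S x → x ≤ s) ×
                           (∀ b → (∀ x → S x → x ≤ b) → s ≤ b)

  _-_ : Carrier → Carrier → Carrier
  x - y = x + (- y)

-- Projective-plane geometry over a model of the reals, in homogeneous
-- coordinates.  A point of RP² is represented by a nonzero vector of R³;
-- a line by a nonzero covector; projective equality is proportionality.

module Geometry (R : RealField) where
  open RealField R

  record V3 : Set where
    constructor vec
    field
      x y z : Carrier
  open V3 public

  zero3 : V3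
  zero3 = vec 0# 0# 0#

  NonZero3 : V3 → Set
  NonZero3 v = ¬ (v ≡ zero3)

  scale : Carrier → V3 → V3
  scale c (vec a b d) = vec (c * a) (c * b) (c * d)

  Proportional : V3 → V3 → Set
  Proportional p q = ∃ λ c → ¬ (c ≡ 0#) × p ≡ scale c q

  dot : V3 → V3 → Carrier
  dot (vec a b c) (vec a' b' c') = a * a' + b * b' + c * c'

  -- cross product: the line through two points / the meet of two lines
  cross : V3 → V3 → V3
  cross (vec a b c) (vec a' b' c') =
    vec (b * c' - c * b') (c * a' - a * c') (a * b' - b * a')

  det3 : V3 → V3 → V3 → Carrier
  det3 u v w = dot u (cross v w)

  record Mat3 : Set where
    constructor mat
    field
      r1 r2 r3 : V3

  apply : Mat3 → V3 → V3
  apply (mat r1 r2 r3) v = vec (dot r1 v) (dot r2 v) (dot r3 v)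

  detM : Mat3 → Carrier
  detM (mat r1 r2 r3) = det3 r1 r2 r3

  IsProjectiveTransformation : Mat3 → Set
  IsProjectiveTransformation M = ¬ (detM M ≡ 0#)

  FixesInfinity : Mat3 → Set
  FixesInfinity M = ∀ a b → NonZero3 (vec a b 0#) →
                    Proportional (apply M (vec a b 0#)) (vec a b 0#)

  R2 : Set
  R2 = Carrier × Carrier

  lift : R2 → V3
  lift (a , b) = vec a b 1#

  Horizontal : (ℤ → R2) → ℤ → Set
  Horizontal A i with A i | A (i ℤ.+ ℤ.1ℤ)
  ... | (_ , b) | (_ , b') = b ≡ b'

  Vertical : (ℤ → R2) → ℤ → Set
  Vertical A i with A i | A (i ℤ.+ ℤ.1ℤ)
  ... | (a , _) | (a' , _) = a ≡ a'

  AxisAligned : (ℤ → R2) → Set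
  AxisAligned A =
    (∀ j → Horizontal A (ℤ.+ 2 ℤ.* j) × Vertical A (ℤ.+ 2 ℤ.* j ℤ.+ ℤ.1ℤ))
    Data.Sum.⊎
    (∀ j → Vertical A (ℤ.+ 2 ℤ.* j) × Horizontal A (ℤ.+ 2 ℤ.* j ℤ.+ ℤ.1ℤ))
    where import Data.Sum

  Twisted : ℕ → Mat3 → (ℤ → R2) → Set
  Twisted n M A = ∀ i → Proportional (lift (A (i ℤ.+ ℤ.+ (2 Data.Nat.* n))))
                                     (apply M (lift (A i)))
    where import Data.Nat

  -- Pentagram map on representatives.  Convention: at level k the
  -- sequence P : ℤ → V3 has P i representing the vertex of index i + k/2.
  -- Then T(P) i = (P(i-1) P(i+1)) ∩ (P(i) P(i+2)), i.e.
  -- B_j = A_{j-3/2}A_{j+1/2} ∩ A_{j-1/2}A_{j+3/2} with j = i + (k+1)/2.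
  pentagram : (ℤ → V3) → (ℤ → V3)
  pentagram P i = cross (cross (P (i ℤ.- ℤ.1ℤ)) (P (i ℤ.+ ℤ.1ℤ)))
                        (cross (P i) (P (i ℤ.+ ℤ.+ 2)))

  iterT : ℕ → (ℤ → V3) → (ℤ → V3)
  iterT zero    P = P
  iterT (suc k) P = pentagram (iterT k P)

  -- T^m(P) is defined: every intersection in the first m steps exists,
  -- i.e. every representative computed is nonzero (a zero cross product
  -- means two coinciding points or two coinciding lines).
  DefinedUpTo : ℕ → (ℤ → V3) → Set
  DefinedUpTo m P = ∀ k → k ≤ℕ m → ∀ i → NonZero3 (iterT k P i)

  NoThreeConsecutiveCollinear : (ℤ → V3) → Set
  NoThreeConsecutiveCollinear B =
    ∀ i → ¬ (det3 (B i) (B (i ℤ.+ ℤ.1ℤ)) (B (i ℤ.+ ℤ.+ 2)) ≡ 0#)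

  Incident : V3 → V3 → Set
  Incident L p = dot L p ≡ 0#

{-# OPTIONS --safe #-}

-- Let δ i be the signed length of the side from A i to A (i+1). If Σ c_j δ (s+2j) = 0, then
-- Σ c_j A (s+2j) = Σ c_j A (s+1+2j), because the sides at s, s+2, s+4, ... are parallel.
-- Each vertex of the k-th iterate is Σ_{j≤k} c_j A (s+2j), where c spans the kernel of the k functionals
-- c ↦ Σ c_j δ (s+t+2j), t < k. Indeed, up to shifting the base index by one, both lines that meet in a vertex
-- of the next iterate consist of combinations of this kind, one for the functionals t < k and the other for
-- 1 ≤ t ≤ k; the vertices being defined forces the kernels to be one-dimensional.
-- Now φ is a homothety or a translation v ↦ r v + C, so that δ (i+2n) = r δ i. For k = n-1 there are n
-- coefficients, and (r c_1, ..., r c_{n-1}, c_0) satisfies the conditions for the base index s+2. Hence the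
-- next vertex of the same parity is proportional to r p + c_0 C, where p is the current one, and all of these
-- vertices lie on the line joining p and C.
module Submission where

open import Defs
open import Data.Nat using (ℕ; zero; suc)
import Data.Nat as ℕ
import Data.Nat.Properties as ℕₚ
open import Data.Integer using (ℤ)
import Data.Integer as ℤ
import Data.Integer.Properties as ℤₚ
open import Data.Integer.DivMod using (_%ℕ_; _/ℕ_; n%ℕd<d; a≡a%ℕn+[a/ℕn]*n)
open import Data.Integer.Solver using (module +-*-Solver)
open +-*-Solver using ()
  renaming (solve to ℤsolve; _:+_ to _ℤ:+_; _:*_ to _ℤ:*_; _:-_ to _ℤ:-_; _:=_ to _ℤ:=_; con to ℤcon)
open import Data.Maybe using (Maybe; just; nothing)
open import Data.Product using (∃; _×_; _,_; proj₁; proj₂)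
open import Data.Sum using (_⊎_; inj₁; inj₂)
open import Data.Vec using (Vec; []; _∷_; _∷ʳ_; map; zipWith)
import Data.Vec.Properties as Vecₚ
open import Relation.Binary.PropositionalEquality
  using (_≡_; _≢_; refl; sym; trans; cong; cong₂; subst; subst₂; module ≡-Reasoning)
open import Relation.Binary.Structures using (IsTotalOrder)
open import Relation.Nullary using (¬_; Dec; yes; no; contradiction)
open import Algebra.Bundles using (CommutativeRing; RawRing)
open import Algebra.Structures using (IsCommutativeRing)
import Algebra.Properties.Ring
import Algebra.Properties.Semiring.Mult
import Algebra.Solver.Ring
open import Algebra.Solver.Ring.AlmostCommutativeRing
  using (fromCommutativeRing; _-Raw-AlmostCommutative⟶_)

-- Arithmetic of the real field and decidability of being zero.

module Field (R : RealField) where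
  open RealField R public renaming (_≤_ to _⊑_)
  open IsCommutativeRing isCommutativeRing public
    using (+-assoc; +-comm; +-identityˡ; +-identityʳ; -‿inverseʳ; -‿inverseˡ;
           *-assoc; *-comm; *-identityˡ; *-identityʳ; zeroˡ; zeroʳ; distribˡ; distribʳ)
  module ⊑ = IsTotalOrder isTotalOrder

  commutativeRing : CommutativeRing _ _
  commutativeRing = record { isCommutativeRing = isCommutativeRing }

  open CommutativeRing commutativeRing using (ring; semiring)
  open Algebra.Properties.Ring ring using (-0#≈0#; -‿distribˡ-*; -‿distribʳ-*; -‿involutive; -‿+-comm)
  open Algebra.Properties.Semiring.Mult semiring using (×1-homo-*; ×-homo-+) renaming (_×_ to _·_)

  private
    cancel : ℕ × ℕ → ℕ × ℕ
    cancel (suc a , suc b) = cancel (a , b)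
    cancel p               = p

    -- The ring solver compares normal forms definitionally, so it needs coefficients that compute to
    -- canonical forms: the pair (a , b) stands for a - b, and cancel makes one of the entries zero.
    coefficients : RawRing _ _
    coefficients = record
      { Carrier = ℕ × ℕ
      ; _≈_ = λ (a , b) (c , d) → a ℕ.+ d ≡ c ℕ.+ b
      ; _+_ = λ (a , b) (c , d) → cancel (a ℕ.+ c , b ℕ.+ d)
      ; _*_ = λ (a , b) (c , d) → cancel (a ℕ.* c ℕ.+ b ℕ.* d , a ℕ.* d ℕ.+ b ℕ.* c)
      ; -_ = λ (a , b) → b , a
      ; 0# = 0 , 0
      ; 1# = 1 , 0
      }

    diff : ℕ × ℕ → Carrier
    diff (a , b) = a · 1# - b · 1#

    open ≡-Reasoning

    -- The identities up to `cross-sum` are derived by hand, because the ring solver is built from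
    -- them.
    +-interchange : ∀ w x y z → (w + x) + (y + z) ≡ (w + y) + (x + z)
    +-interchange w x y z = begin
      (w + x) + (y + z) ≡⟨ +-assoc w x (y + z) ⟩
      w + (x + (y + z)) ≡⟨ cong (w +_) (+-assoc x y z) ⟨
      w + (x + y + z)   ≡⟨ cong (λ t → w + (t + z)) (+-comm x y) ⟩
      w + (y + x + z)   ≡⟨ cong (w +_) (+-assoc y x z) ⟩
      w + (y + (x + z)) ≡⟨ +-assoc w y (x + z) ⟨
      (w + y) + (x + z) ∎

    diff-cancel : ∀ a b → diff (cancel (a , b)) ≡ diff (a , b)
    diff-cancel zero    b       = refl
    diff-cancel (suc a) zero    = refl
    diff-cancel (suc a) (suc b) = begin
      diff (cancel (a , b))                 ≡⟨ diff-cancel a b ⟩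
      diff (a , b)                          ≡⟨ +-identityˡ _ ⟨
      0# + diff (a , b)                     ≡⟨ cong (_+ diff (a , b)) (-‿inverseʳ 1#) ⟨
      (1# - 1#) + diff (a , b)              ≡⟨ +-interchange _ _ _ _ ⟩
      (1# + a · 1#) + (- 1# + - (b · 1#))   ≡⟨ cong ((1# + a · 1#) +_) (-‿+-comm _ _) ⟩
      diff (suc a , suc b) ∎

    diff-+-homo : ∀ p q → diff (RawRing._+_ coefficients p q) ≡ diff p + diff q
    diff-+-homo (a , b) (c , d) = begin
      diff (cancel (a ℕ.+ c , b ℕ.+ d))
        ≡⟨ diff-cancel (a ℕ.+ c) (b ℕ.+ d) ⟩
      (a ℕ.+ c) · 1# - (b ℕ.+ d) · 1#
        ≡⟨ cong₂ _-_ (×-homo-+ 1# a c) (×-homo-+ 1# b d) ⟩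
      (a · 1# + c · 1#) - (b · 1# + d · 1#)
        ≡⟨ cong ((a · 1# + c · 1#) +_) (-‿+-comm (b · 1#) (d · 1#)) ⟨
      (a · 1# + c · 1#) + (- (b · 1#) + - (d · 1#))
        ≡⟨ +-interchange _ _ _ _ ⟩
      diff (a , b) + diff (c , d) ∎

    difference-* : ∀ w x y z → (w - x) * (y - z) ≡ (w * y + x * z) - (w * z + x * y)
    difference-* w x y z = begin
      (w - x) * (y - z)
        ≡⟨ distribʳ (y - z) w (- x) ⟩
      w * (y - z) + - x * (y - z)
        ≡⟨ cong₂ _+_ (distribˡ w y (- z)) (distribˡ (- x) y (- z)) ⟩
      (w * y + w * - z) + (- x * y + - x * - z)
        ≡⟨ cong ((w * y + w * - z) +_) (+-comm _ _) ⟩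
      (w * y + w * - z) + (- x * - z + - x * y)
        ≡⟨ +-interchange _ _ _ _ ⟩
      (w * y + - x * - z) + (w * - z + - x * y)
        ≡⟨ cong₂ (λ s t → (w * y + s) + t)
             (trans (sym (-‿distribˡ-* x (- z))) (trans (cong -_ (sym (-‿distribʳ-* x z))) (-‿involutive _)))
             (trans (cong₂ _+_ (sym (-‿distribʳ-* w z)) (sym (-‿distribˡ-* x y))) (-‿+-comm _ _)) ⟩
      (w * y + x * z) - (w * z + x * y) ∎

    diff-*-homo : ∀ p q → diff (RawRing._*_ coefficients p q) ≡ diff p * diff q
    diff-*-homo (a , b) (c , d) = begin
      diff (cancel (a ℕ.* c ℕ.+ b ℕ.* d , a ℕ.* d ℕ.+ b ℕ.* c))
        ≡⟨ diff-cancel (a ℕ.* c ℕ.+ b ℕ.* d) (a ℕ.* d ℕ.+ b ℕ.* c) ⟩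
      diff (a ℕ.* c ℕ.+ b ℕ.* d , a ℕ.* d ℕ.+ b ℕ.* c)
        ≡⟨ cong₂ _-_ (products a c b d) (products a d b c) ⟩
      (a · 1# * (c · 1#) + b · 1# * (d · 1#)) - (a · 1# * (d · 1#) + b · 1# * (c · 1#))
        ≡⟨ difference-* _ _ _ _ ⟨
      diff (a , b) * diff (c , d) ∎
      where
      products : ∀ k l m n → (k ℕ.* l ℕ.+ m ℕ.* n) · 1# ≡ k · 1# * (l · 1#) + m · 1# * (n · 1#)
      products k l m n = trans (×-homo-+ 1# (k ℕ.* l) (m ℕ.* n)) (cong₂ _+_ (×1-homo-* k l) (×1-homo-* m n))

    diff-neg : ∀ p → diff (RawRing.-_ coefficients p) ≡ - diff p
    diff-neg (a , b) = begin
      b · 1# - a · 1#           ≡⟨ cong (_+ - (a · 1#)) (-‿involutive _) ⟨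
      - - (b · 1#) - a · 1#     ≡⟨ +-comm _ _ ⟩
      - (a · 1#) + - - (b · 1#) ≡⟨ -‿+-comm _ _ ⟩
      - (a · 1# - b · 1#)       ∎

    -- Makes the coefficient test `_coeff≟_` sound; inserting `D - D` brings the hypothesis into
    -- play.
    cross-sum : ∀ a b c d → a ℕ.+ d ≡ c ℕ.+ b → diff (a , b) ≡ diff (c , d)
    cross-sum a b c d eq = begin
      A - B             ≡⟨ +-identityʳ _ ⟨
      A - B + 0#        ≡⟨ cong (A - B +_) (-‿inverseʳ D) ⟨
      (A - B) + (D - D) ≡⟨ +-interchange _ _ _ _ ⟩
      (A + D) + (- B - D) ≡⟨ cong (_+ (- B - D)) (trans (sym (×-homo-+ 1# a d)) (trans (cong (_· 1#) eq) (×-homo-+ 1# c b))) ⟩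
      (C + B) + (- B - D) ≡⟨ cong ((C + B) +_) (+-comm _ _) ⟩
      (C + B) + (- D - B) ≡⟨ +-interchange _ _ _ _ ⟩
      (C - D) + (B - B) ≡⟨ cong (C - D +_) (-‿inverseʳ B) ⟩
      C - D + 0#        ≡⟨ +-identityʳ _ ⟩
      C - D ∎
      where
      A = a · 1#
      B = b · 1#
      C = c · 1#
      D = d · 1#

    -- Agrees with diff, but 0# and 1# are denoted by their coefficients definitionally.
    ⟦_⟧ : ℕ × ℕ → Carrier
    ⟦ 0 , 0 ⟧ = 0#
    ⟦ 1 , 0 ⟧ = 1#
    ⟦ p ⟧     = diff p

    diff-0 : diff (0 , 0) ≡ 0#
    diff-0 = -‿inverseʳ 0#

    diff-1 : diff (1 , 0) ≡ 1#
    diff-1 = trans (cong₂ _+_ (+-identityʳ 1#) -0#≈0#) (+-identityʳ 1#)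

    ⟦⟧-diff : ∀ p → ⟦ p ⟧ ≡ diff p
    ⟦⟧-diff (0 , 0)           = sym diff-0
    ⟦⟧-diff (0 , suc b)       = refl
    ⟦⟧-diff (1 , 0)           = sym diff-1
    ⟦⟧-diff (1 , suc b)       = refl
    ⟦⟧-diff (suc (suc a) , b) = refl

    morphism : coefficients -Raw-AlmostCommutative⟶ fromCommutativeRing commutativeRing
    morphism = record
      { ⟦_⟧ = ⟦_⟧
      ; +-homo = λ p q → trans (⟦⟧-diff (RawRing._+_ coefficients p q)) (trans (diff-+-homo p q) (sym (cong₂ _+_ (⟦⟧-diff p) (⟦⟧-diff q))))
      ; *-homo = λ p q → trans (⟦⟧-diff (RawRing._*_ coefficients p q)) (trans (diff-*-homo p q) (sym (cong₂ _*_ (⟦⟧-diff p) (⟦⟧-diff q))))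
      ; -‿homo = λ p → trans (⟦⟧-diff (RawRing.-_ coefficients p)) (trans (diff-neg p) (sym (cong -_ (⟦⟧-diff p))))
      ; 0-homo = refl
      ; 1-homo = refl
      }

    _coeff≟_ : ∀ p q → Maybe (⟦ p ⟧ ≡ ⟦ q ⟧)
    (a , b) coeff≟ (c , d) with a ℕ.+ d ℕ.≟ c ℕ.+ b
    ... | yes eq = just (trans (⟦⟧-diff (a , b)) (trans (cross-sum a b c d eq) (sym (⟦⟧-diff (c , d)))))
    ... | no _   = nothing

  module Solver = Algebra.Solver.Ring coefficients (fromCommutativeRing commutativeRing) morphism _coeff≟_
  open Solver public using (solve; _:+_; _:*_; _:-_; :-_; _:=_; con)

  :0 :1 : ∀ {n} → Solver.Polynomial n
  :0 = con (0 , 0)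
  :1 = con (1 , 0)

  0⊑1 : 0# ⊑ 1#
  0⊑1 with ⊑.total 0# 1#
  ... | inj₁ 0⊑1 = 0⊑1
  ... | inj₂ 1⊑0 = subst (0# ⊑_) (solve 0 ((:- :1) :* (:- :1) := :1) refl) (*-nonneg _ _ 0⊑-1 0⊑-1)
    where
    0⊑-1 : 0# ⊑ - 1#
    0⊑-1 = subst₂ _⊑_ (-‿inverseʳ 1#) (+-identityˡ (- 1#)) (+-mono-≤ 1# 0# (- 1#) 1⊑0)

  1⋢0 : ¬ (1# ⊑ 0#)
  1⋢0 1⊑0 = 0≢1 (⊑.antisym 0⊑1 1⊑0)

  -- The elements that are not nonzero form a subgroup bounded by 1, so their supremum s satisfies s ⊑ s - x.
  ¬¬0⇒⊑0 : ∀ x → ¬ ¬ (x ≡ 0#) → x ⊑ 0#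
  ¬¬0⇒⊑0 x ¬¬x≡0 = subst₂ _⊑_
    (solve 2 (λ s x → s :+ (x :- s) := x) refl s x) (solve 2 (λ s x → s :- x :+ (x :- s) := :0) refl s x)
    (+-mono-≤ s (s - x) (x - s) (least (s - x) shifted))
    where
    NotNonzero : Carrier → Set
    NotNonzero y = ¬ ¬ (y ≡ 0#)

    bounded : ∀ y → NotNonzero y → y ⊑ 1#
    bounded y ¬¬y≡0 with ⊑.total y 1#
    ... | inj₁ y⊑1 = y⊑1
    ... | inj₂ 1⊑y = contradiction (λ y≡0 → 1⋢0 (subst (1# ⊑_) y≡0 1⊑y)) ¬¬y≡0

    sup = completeness NotNonzero (x , ¬¬x≡0) (1# , bounded)
    s = proj₁ sup
    upper = proj₁ (proj₂ sup)
    least = proj₂ (proj₂ sup)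

    shifted : ∀ y → NotNonzero y → y ⊑ s - x
    shifted y ¬¬y≡0 = subst (_⊑ s - x) (solve 2 (λ y x → y :+ x :- x := y) refl y x)
      (+-mono-≤ (y + x) s (- x) (upper (y + x) λ y+x≢0 → ¬¬y≡0 λ y≡0 → ¬¬x≡0 λ x≡0 →
        y+x≢0 (trans (cong₂ _+_ y≡0 x≡0) (+-identityʳ 0#))))

  -- The hypothesis passes from `x` to `- x`, so `¬¬0⇒⊑0` bounds `x` from both sides.
  ≡0-stable : ∀ x → ¬ ¬ (x ≡ 0#) → x ≡ 0#
  ≡0-stable x ¬¬x≡0 = ⊑.antisym (¬¬0⇒⊑0 x ¬¬x≡0)
    (subst₂ _⊑_ (-‿inverseˡ x) (+-identityˡ x) (+-mono-≤ (- x) 0# x (¬¬0⇒⊑0 (- x) λ -x≢0 →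
      ¬¬x≡0 λ x≡0 → -x≢0 (trans (cong -_ x≡0) -0#≈0#))))

  -- Compare 1 with the supremum of the set consisting of 0 and, provided P holds, 2.
  weak-excluded-middle : (P : Set) → ¬ P ⊎ ¬ ¬ P
  weak-excluded-middle P with completeness S (0# , inj₁ refl) (1# + 1# , bounded)
    where
    S : Carrier → Set
    S y = y ≡ 0# ⊎ (y ≡ 1# + 1# × P)

    bounded : ∀ y → S y → y ⊑ 1# + 1#
    bounded y (inj₁ refl) = ⊑.trans 0⊑1 (subst (_⊑ 1# + 1#) (+-identityˡ 1#) (+-mono-≤ 0# 1# 1# 0⊑1))
    bounded y (inj₂ (refl , _)) = ⊑.refl
  ... | s , upper , least with ⊑.total s 1#
  -- If `P` held, 2 would lie in `S`, so that 2 ⊑ s ⊑ 1.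
  ... | inj₁ s⊑1 = inj₁ λ p → 1⋢0 (subst₂ _⊑_
          (solve 0 (:1 :+ :1 :- :1 := :1) refl) (-‿inverseʳ 1#)
          (+-mono-≤ _ _ (- 1#) (⊑.trans (upper (1# + 1#) (inj₂ (refl , p))) s⊑1)))
  -- If `P` failed, 0 would be an upper bound of `S`, so that 1 ⊑ s ⊑ 0.
  ... | inj₂ 1⊑s = inj₂ λ ¬p → 1⋢0 (⊑.trans 1⊑s (least 0# λ
          { y (inj₁ refl) → ⊑.refl ; y (inj₂ (_ , p)) → contradiction p ¬p }))

  -- Completeness supplies the case distinction without a classical axiom: weak excluded middle
  -- decides up to double negation, and stability removes the latter.
  ≡0? : ∀ x → Dec (x ≡ 0#)
  ≡0? x with weak-excluded-middle (x ≡ 0#)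
  ... | inj₁ x≢0   = no x≢0
  ... | inj₂ ¬¬x≡0 = yes (≡0-stable x ¬¬x≡0)

  cancel-*ˡ : ∀ {x y} → x ≢ 0# → x * y ≡ 0# → y ≡ 0#
  cancel-*ˡ {x} {y} x≢0 xy≡0 with x⁻¹ , xx⁻¹≡1 ← inverse x x≢0 = begin
    y               ≡⟨ *-identityˡ y ⟨
    1# * y          ≡⟨ cong (_* y) xx⁻¹≡1 ⟨
    x * x⁻¹ * y     ≡⟨ solve 3 (λ x i y → x :* i :* y := i :* (x :* y)) refl x x⁻¹ y ⟩
    x⁻¹ * (x * y)   ≡⟨ cong (x⁻¹ *_) xy≡0 ⟩
    x⁻¹ * 0#        ≡⟨ zeroʳ x⁻¹ ⟩
    0#              ∎

module Vectors (R : RealField) where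
  open Field R
  open Geometry R

  infixl 6 _⊕_ _+ᵛ_
  infixl 7 _*ᵛ_

  _⊕_ : V3 → V3 → V3
  vec a b c ⊕ vec a' b' c' = vec (a + a') (b + b') (c + c')

  vec-≡ : ∀ {a b c a' b' c'} → a ≡ a' → b ≡ b' → c ≡ c' → vec a b c ≡ vec a' b' c'
  vec-≡ refl refl refl = refl

  scale-zero : ∀ v → scale 0# v ≡ zero3
  scale-zero (vec a b c) = vec-≡ (zeroˡ a) (zeroˡ b) (zeroˡ c)

  scale-zero3 : ∀ r → scale r zero3 ≡ zero3
  scale-zero3 r = vec-≡ (zeroʳ r) (zeroʳ r) (zeroʳ r)

  scale≡0⇒≡0 : ∀ {r v} → NonZero3 v → scale r v ≡ zero3 → r ≡ 0#
  scale≡0⇒≡0 {r} {vec a b c} v≢0 rv≡0 with ≡0? r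
  ... | yes r≡0 = r≡0
  ... | no r≢0  = contradiction (vec-≡ (cancel-*ˡ r≢0 (cong V3.x rv≡0))
                                       (cancel-*ˡ r≢0 (cong V3.y rv≡0))
                                       (cancel-*ˡ r≢0 (cong V3.z rv≡0))) v≢0

  cross-scale : ∀ r s u v → cross (scale r u) (scale s v) ≡ scale (r * s) (cross u v)
  cross-scale r s (vec a b c) (vec a' b' c') = vec-≡ (minor b c b' c') (minor c a c' a') (minor a b a' b')
    where
    minor : ∀ d e d' e' → r * d * (s * e') - r * e * (s * d') ≡ r * s * (d * e' - e * d')
    minor = solve 6 (λ r s d e d' e' → r :* d :* (s :* e') :- r :* e :* (s :* d')
                                    := r :* s :* (d :* e' :- e :* d')) refl r s

  cross-zeroˡ : ∀ v → cross zero3 v ≡ zero3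
  cross-zeroˡ (vec a b c) = vec-≡ (minor b c) (minor c a) (minor a b)
    where
    minor : ∀ d e → 0# * e - 0# * d ≡ 0#
    minor = solve 2 (λ d e → :0 :* e :- :0 :* d := :0) refl

  cross-zeroʳ : ∀ v → cross v zero3 ≡ zero3
  cross-zeroʳ (vec a b c) = vec-≡ (minor b c) (minor c a) (minor a b)
    where
    minor : ∀ d e → d * 0# - e * 0# ≡ 0#
    minor = solve 2 (λ d e → d :* :0 :- e :* :0 := :0) refl

  cross-multiple : ∀ r v → cross (scale r v) v ≡ zero3
  cross-multiple r (vec a b c) = vec-≡ (minor b c) (minor c a) (minor a b)
    where
    minor : ∀ d e → r * d * e - r * e * d ≡ 0#
    minor = solve 3 (λ r d e → r :* d :* e :- r :* e :* d := :0) refl r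

  cross-combinationˡ : ∀ r s u v → cross (scale r u ⊕ scale s v) v ≡ scale r (cross u v)
  cross-combinationˡ r s (vec a b c) (vec a' b' c') = vec-≡ (minor b c b' c') (minor c a c' a') (minor a b a' b')
    where
    minor : ∀ d e d' e' → (r * d + s * d') * e' - (r * e + s * e') * d' ≡ r * (d * e' - e * d')
    minor = solve 6 (λ r s d e d' e' → (r :* d :+ s :* d') :* e' :- (r :* e :+ s :* e') :* d'
                                    := r :* (d :* e' :- e :* d')) refl r s

  cross-combinationʳ : ∀ r s u v → cross u (scale r u ⊕ scale s v) ≡ scale s (cross u v)
  cross-combinationʳ r s (vec a b c) (vec a' b' c') = vec-≡ (minor b c b' c') (minor c a c' a') (minor a b a' b')
    where
    minor : ∀ d e d' e' → d * (r * e + s * e') - e * (r * d + s * d') ≡ s * (d * e' - e * d')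
    minor = solve 6 (λ r s d e d' e' → d :* (r :* e :+ s :* e') :- e :* (r :* d :+ s :* d')
                                    := s :* (d :* e' :- e :* d')) refl r s

  -- Crossing the relation with `v` isolates `r`, and crossing it with `u` isolates `s`.
  independent : ∀ {r s u v} → NonZero3 (cross u v) → scale r u ⊕ scale s v ≡ zero3 → r ≡ 0# × s ≡ 0#
  independent {r} {s} {u} {v} uv≢0 eq =
    scale≡0⇒≡0 uv≢0 (trans (sym (cross-combinationˡ r s u v)) (trans (cong (λ t → cross t v) eq) (cross-zeroˡ v))) ,
    scale≡0⇒≡0 uv≢0 (trans (sym (cross-combinationʳ r s u v)) (trans (cong (cross u) eq) (cross-zeroʳ u)))

  dot-scale : ∀ r u v → dot u (scale r v) ≡ r * dot u v
  dot-scale r (vec a b c) (vec d e f) =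
    solve 7 (λ r a b c d e f → a :* (r :* d) :+ b :* (r :* e) :+ c :* (r :* f)
                            := r :* (a :* d :+ b :* e :+ c :* f)) refl r a b c d e f

  dot-linear : ∀ r s u v w → dot u (scale r v ⊕ scale s w) ≡ r * dot u v + s * dot u w
  dot-linear r s (vec a b c) (vec d e f) (vec g h i) =
    solve 11 (λ r s a b c d e f g h i →
      a :* (r :* d :+ s :* g) :+ b :* (r :* e :+ s :* h) :+ c :* (r :* f :+ s :* i)
      := r :* (a :* d :+ b :* e :+ c :* f) :+ s :* (a :* g :+ b :* h :+ c :* i)) refl r s a b c d e f g h i

  dot-crossˡ : ∀ u v → dot (cross u v) u ≡ 0#
  dot-crossˡ (vec a b c) (vec d e f) =
    solve 6 (λ a b c d e f →
      (b :* f :- c :* e) :* a :+ (c :* d :- a :* f) :* b :+ (a :* e :- b :* d) :* c := :0) refl a b c d e f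

  dot-crossʳ : ∀ u v → dot (cross u v) v ≡ 0#
  dot-crossʳ (vec a b c) (vec d e f) =
    solve 6 (λ a b c d e f →
      (b :* f :- c :* e) :* d :+ (c :* d :- a :* f) :* e :+ (a :* e :- b :* d) :* f := :0) refl a b c d e f

  linear-zero : ∀ r s {t t'} → t ≡ 0# → t' ≡ 0# → r * t + s * t' ≡ 0#
  linear-zero r s refl refl = trans (cong₂ _+_ (zeroʳ r) (zeroʳ s)) (+-identityʳ 0#)

  incident-combination : ∀ r s u v → dot (cross u v) (scale r u ⊕ scale s v) ≡ 0#
  incident-combination r s u v =
    trans (dot-linear r s (cross u v) u v) (linear-zero r s (dot-crossˡ u v) (dot-crossʳ u v))

  -- The expansion (l × m) × v = (l · v) m - (m · v) l. The other two coordinates follow from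
  -- `minor` by cyclic permutation, for which `rotate` and `rotate'` reorder the dot products.
  cross-meet : ∀ l m v → dot l v ≡ 0# → dot m v ≡ 0# → cross (cross l m) v ≡ zero3
  cross-meet (vec a b c) (vec d e f) (vec g h i) lv≡0 mv≡0 =
    vec-≡ (trans (minor a b c d e f g h i) (linear-zero _ _ lv≡0 mv≡0))
          (trans (minor b c a e f d h i g) (linear-zero _ _ (trans (rotate b c a h i g) lv≡0) (trans (rotate e f d h i g) mv≡0)))
          (trans (minor c a b f d e i g h) (linear-zero _ _ (trans (rotate' c a b i g h) lv≡0) (trans (rotate' f d e i g h) mv≡0)))
    where
    minor : ∀ a b c d e f g h i → (c * d - a * f) * i - (a * e - b * d) * h
      ≡ d * (a * g + b * h + c * i) + - a * (d * g + e * h + f * i)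
    minor = solve 9 (λ a b c d e f g h i → (c :* d :- a :* f) :* i :- (a :* e :- b :* d) :* h
      := d :* (a :* g :+ b :* h :+ c :* i) :+ :- a :* (d :* g :+ e :* h :+ f :* i)) refl
    rotate : ∀ a b c g h i → a * g + b * h + c * i ≡ c * i + a * g + b * h
    rotate = solve 6 (λ a b c g h i → a :* g :+ b :* h :+ c :* i := c :* i :+ a :* g :+ b :* h) refl
    rotate' : ∀ a b c g h i → a * g + b * h + c * i ≡ b * h + c * i + a * g
    rotate' = solve 6 (λ a b c g h i → a :* g :+ b :* h :+ c :* i := b :* h :+ c :* i :+ a :* g) refl

  x-y≡0⇒x≡y : ∀ x y → x - y ≡ 0# → x ≡ y
  x-y≡0⇒x≡y x y eq = trans (solve 2 (λ x y → x := x :- y :+ y) refl x y) (trans (cong (_+ y) eq) (+-identityˡ y))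

  -- The factor is the ratio of the coordinates at a position where `v` does not vanish.
  cross≡0⇒multiple : ∀ {u v} → NonZero3 v → cross u v ≡ zero3 → ∃ λ r → u ≡ scale r v
  cross≡0⇒multiple {vec a b c} {vec d e f} v≢0 uv≡0 = choose (≡0? d) (≡0? e) (≡0? f)
    where
    bf≡ce = x-y≡0⇒x≡y _ _ (cong V3.x uv≡0)
    cd≡af = x-y≡0⇒x≡y _ _ (cong V3.y uv≡0)
    ae≡bd = x-y≡0⇒x≡y _ _ (cong V3.z uv≡0)

    quotient : ∀ {d i} → d * i ≡ 1# → ∀ a b e → a * e ≡ b * d → b ≡ a * i * e
    quotient {d} {i} di≡1 a b e ae≡bd = begin
      b           ≡⟨ *-identityʳ b ⟨
      b * 1#      ≡⟨ cong (b *_) di≡1 ⟨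
      b * (d * i) ≡⟨ *-assoc b d i ⟨
      b * d * i   ≡⟨ cong (_* i) ae≡bd ⟨
      a * e * i   ≡⟨ solve 3 (λ a e i → a :* e :* i := a :* i :* e) refl a e i ⟩
      a * i * e   ∎
      where open ≡-Reasoning

    choose : Dec (d ≡ 0#) → Dec (e ≡ 0#) → Dec (f ≡ 0#) → ∃ λ r → vec a b c ≡ scale r (vec d e f)
    choose (no d≢0) _ _ with i , di≡1 ← inverse d d≢0 =
      a * i , vec-≡ (quotient di≡1 a a d refl) (quotient di≡1 a b e ae≡bd) (quotient di≡1 a c f (sym cd≡af))
    choose _ (no e≢0) _ with i , ei≡1 ← inverse e e≢0 =
      b * i , vec-≡ (quotient ei≡1 b a d (sym ae≡bd)) (quotient ei≡1 b b e refl) (quotient ei≡1 b c f bf≡ce)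
    choose _ _ (no f≢0) with i , fi≡1 ← inverse f f≢0 =
      c * i , vec-≡ (quotient fi≡1 c a d cd≡af) (quotient fi≡1 c b e (sym bf≡ce)) (quotient fi≡1 c c f refl)
    choose (yes d≡0) (yes e≡0) (yes f≡0) = contradiction (vec-≡ d≡0 e≡0 f≡0) v≢0

  -- A nonzero functional on a plane has a one-dimensional kernel, spanned here by `(b , - a)`. The
  -- factor is `- t / a` or `r / b`, whichever makes sense.
  kernel-multiple : ∀ {a b} → ¬ (a ≡ 0# × b ≡ 0#) → ∀ r t → r * a + t * b ≡ 0# → ∃ λ m → m * b ≡ r × m * - a ≡ t
  kernel-multiple {a} {b} ab≢0 r t ra+tb≡0 = choose (≡0? a) (≡0? b)
    where
    open ≡-Reasoning
    choose : Dec (a ≡ 0#) → Dec (b ≡ 0#) → ∃ λ m → m * b ≡ r × m * - a ≡ t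
    choose (yes a≡0) (yes b≡0) = contradiction (a≡0 , b≡0) ab≢0
    choose (no a≢0) _ with i , ai≡1 ← inverse a a≢0 = - t * i ,
      (begin
        - t * i * b ≡⟨ solve 5 (λ a b r t i → (:- t) :* i :* b := r :* (a :* i) :- i :* (r :* a :+ t :* b)) refl a b r t i ⟩
        r * (a * i) - i * (r * a + t * b) ≡⟨ cong₂ (λ y z → r * y - i * z) ai≡1 ra+tb≡0 ⟩
        r * 1# - i * 0# ≡⟨ solve 2 (λ r i → r :* :1 :- i :* :0 := r) refl r i ⟩
        r ∎) ,
      (begin
        - t * i * - a ≡⟨ solve 3 (λ a t i → (:- t) :* i :* (:- a) := t :* (a :* i)) refl a t i ⟩
        t * (a * i)   ≡⟨ cong (t *_) ai≡1 ⟩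
        t * 1#        ≡⟨ *-identityʳ t ⟩
        t ∎)
    choose _ (no b≢0) with i , bi≡1 ← inverse b b≢0 = r * i ,
      (begin
        r * i * b   ≡⟨ solve 3 (λ b r i → r :* i :* b := r :* (b :* i)) refl b r i ⟩
        r * (b * i) ≡⟨ cong (r *_) bi≡1 ⟩
        r * 1#      ≡⟨ *-identityʳ r ⟩
        r ∎) ,
      (begin
        r * i * - a ≡⟨ solve 5 (λ a b r t i → r :* i :* (:- a) := t :* (b :* i) :- i :* (r :* a :+ t :* b)) refl a b r t i ⟩
        t * (b * i) - i * (r * a + t * b) ≡⟨ cong₂ (λ y z → t * y - i * z) bi≡1 ra+tb≡0 ⟩
        t * 1# - i * 0# ≡⟨ solve 2 (λ r i → r :* :1 :- i :* :0 := r) refl t i ⟩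
        t ∎)

  -- Coefficient vectors and their pairing with sequences.

  _+ᵛ_ : ∀ {m} → Vec Carrier m → Vec Carrier m → Vec Carrier m
  _+ᵛ_ = zipWith _+_

  _*ᵛ_ : ∀ {m} → Carrier → Vec Carrier m → Vec Carrier m
  r *ᵛ c = map (r *_) c

  *ᵛ-combination : ∀ {m} r s t (u v : Vec Carrier m) → r *ᵛ (s *ᵛ u +ᵛ t *ᵛ v) ≡ (r * s) *ᵛ u +ᵛ (r * t) *ᵛ v
  *ᵛ-combination r s t []      []      = refl
  *ᵛ-combination r s t (a ∷ u) (b ∷ v) = cong₂ _∷_
    (solve 5 (λ r s t a b → r :* (s :* a :+ t :* b) := r :* s :* a :+ r :* t :* b) refl r s t a b)
    (*ᵛ-combination r s t u v)

  *ᵛ-assoc : ∀ {m} r s (u : Vec Carrier m) → r *ᵛ (s *ᵛ u) ≡ (r * s) *ᵛ u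
  *ᵛ-assoc r s []      = refl
  *ᵛ-assoc r s (a ∷ u) = cong₂ _∷_ (sym (*-assoc r s a)) (*ᵛ-assoc r s u)

  +ᵛ-cancel : ∀ {m} r (u w : Vec Carrier m) → r *ᵛ u +ᵛ (1# *ᵛ w +ᵛ (- r) *ᵛ u) ≡ w
  +ᵛ-cancel r []      []      = refl
  +ᵛ-cancel r (a ∷ u) (b ∷ w) = cong₂ _∷_
    (solve 3 (λ r a b → r :* a :+ (:1 :* b :+ (:- r) :* a) := b) refl r a b) (+ᵛ-cancel r u w)

  multiple-of-scaled : ∀ {m κ} → κ ≢ 0# → {x w : Vec Carrier m} → (∃ λ r → x ≡ r *ᵛ w) → ∃ λ r → x ≡ r *ᵛ (κ *ᵛ w)
  multiple-of-scaled {κ = κ} κ≢0 {w = w} (r , refl) with i , κi≡1 ← inverse κ κ≢0 = r * i , sym (begin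
    (r * i) *ᵛ (κ *ᵛ w) ≡⟨ *ᵛ-assoc (r * i) κ w ⟩
    (r * i * κ) *ᵛ w    ≡⟨ cong (_*ᵛ w) (solve 3 (λ r k i → r :* i :* k := r :* (k :* i)) refl r κ i) ⟩
    (r * (κ * i)) *ᵛ w  ≡⟨ cong (λ z → (r * z) *ᵛ w) κi≡1 ⟩
    (r * 1#) *ᵛ w       ≡⟨ cong (_*ᵛ w) (*-identityʳ r) ⟩
    r *ᵛ w              ∎)
    where open ≡-Reasoning

  -- The index advances by two so that only sides of one parity, which are parallel, occur in a sum.
  pair : ∀ {m} → Vec Carrier m → (ℤ → Carrier) → ℤ → Carrier
  pair []      f s = 0#
  pair (a ∷ c) f s = a * f s + pair c f (ℤ.suc (ℤ.suc s))

  -- Adds 2m, accumulating in the index in order to follow the recursion of `pair` definitionally.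
  advance : ℕ → ℤ → ℤ
  advance zero    s = s
  advance (suc m) s = advance m (ℤ.suc (ℤ.suc s))

  pair-linear : ∀ {m} r t (u v : Vec Carrier m) f s →
    pair (r *ᵛ u +ᵛ t *ᵛ v) f s ≡ r * pair u f s + t * pair v f s
  pair-linear r t []      []      f s = sym (linear-zero r t refl refl)
  pair-linear r t (a ∷ u) (b ∷ v) f s = trans
    (cong ((r * a + t * b) * f s +_) (pair-linear r t u v f _))
    (solve 7 (λ r t a b g p q → (r :* a :+ t :* b) :* g :+ (r :* p :+ t :* q)
                             := r :* (a :* g :+ p) :+ t :* (b :* g :+ q)) refl
           r t a b (f s) (pair u f _) (pair v f _))

  pair-*ᵛ : ∀ {m} r (u : Vec Carrier m) f s → pair (r *ᵛ u) f s ≡ r * pair u f s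
  pair-*ᵛ r []      f s = sym (zeroʳ r)
  pair-*ᵛ r (a ∷ u) f s = trans (cong (r * a * f s +_) (pair-*ᵛ r u f _))
    (solve 4 (λ r a g p → r :* a :* g :+ r :* p := r :* (a :* g :+ p)) refl r a (f s) (pair u f _))

  pair-∷ʳ : ∀ {m} (c : Vec Carrier m) a f s → pair (c ∷ʳ a) f s ≡ pair c f s + a * f (advance m s)
  pair-∷ʳ []      a f s = +-comm _ _
  pair-∷ʳ (b ∷ c) a f s = trans (cong (b * f s +_) (pair-∷ʳ c a f _)) (sym (+-assoc _ _ _))

  pair-∷ʳ-0 : ∀ {m} (c : Vec Carrier m) f s → pair (c ∷ʳ 0#) f s ≡ pair c f s
  pair-∷ʳ-0 c f s = trans (pair-∷ʳ c 0# f s) (trans (cong (pair c f s +_) (zeroˡ _)) (+-identityʳ _))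

  pair-0-∷ : ∀ {m} (c : Vec Carrier m) f s → pair (0# ∷ c) f s ≡ pair c f (ℤ.suc (ℤ.suc s))
  pair-0-∷ c f s = trans (cong (_+ pair c f _) (zeroˡ _)) (+-identityˡ _)

  combine : ∀ {m} → Vec Carrier m → (ℤ → V3) → ℤ → V3
  combine c A s = vec (pair c (λ i → V3.x (A i)) s) (pair c (λ i → V3.y (A i)) s) (pair c (λ i → V3.z (A i)) s)

  combine-linear : ∀ {m} r t (u v : Vec Carrier m) A s →
    combine (r *ᵛ u +ᵛ t *ᵛ v) A s ≡ scale r (combine u A s) ⊕ scale t (combine v A s)
  combine-linear r t u v A s = vec-≡ (pair-linear r t u v _ s) (pair-linear r t u v _ s) (pair-linear r t u v _ s)

  combine-*ᵛ : ∀ {m} r (u : Vec Carrier m) A s → combine (r *ᵛ u) A s ≡ scale r (combine u A s)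
  combine-*ᵛ r u A s = vec-≡ (pair-*ᵛ r u _ s) (pair-*ᵛ r u _ s) (pair-*ᵛ r u _ s)

  combine-∷ʳ-0 : ∀ {m} (c : Vec Carrier m) A s → combine (c ∷ʳ 0#) A s ≡ combine c A s
  combine-∷ʳ-0 c A s = vec-≡ (pair-∷ʳ-0 c _ s) (pair-∷ʳ-0 c _ s) (pair-∷ʳ-0 c _ s)

  combine-0-∷ : ∀ {m} (c : Vec Carrier m) A s → combine (0# ∷ c) A s ≡ combine c A (ℤ.suc (ℤ.suc s))
  combine-0-∷ c A s = vec-≡ (pair-0-∷ c _ s) (pair-0-∷ c _ s) (pair-0-∷ c _ s)

-- Vertices of the iterates as kernels of side-length functionals.

module Iteration (R : RealField) (A : ℤ → Geometry.V3 R) (δ : ℤ → RealField.Carrier R)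
  (slide : ∀ {m} (c : Vec (RealField.Carrier R) m) s → Vectors.pair R c δ s ≡ RealField.0# R →
           Vectors.combine R c A (ℤ.suc s) ≡ Vectors.combine R c A s)
  where

  open Geometry R
  open Field R
  open Vectors R

  -- Accumulating in the index makes `shift (suc t) s` and `shift t (ℤ.suc s)` definitionally equal,
  -- as `annihilates-rest` requires.
  shift : ℕ → ℤ → ℤ
  shift zero    s = s
  shift (suc t) s = shift t (ℤ.suc s)

  shift-suc : ∀ t s → shift t (ℤ.suc s) ≡ ℤ.suc (shift t s)
  shift-suc zero    s = refl
  shift-suc (suc t) s = shift-suc t (ℤ.suc s)

  shift-suc² : ∀ t s → shift t (ℤ.suc (ℤ.suc s)) ≡ ℤ.suc (ℤ.suc (shift t s))
  shift-suc² t s = trans (shift-suc t (ℤ.suc s)) (cong ℤ.suc (shift-suc t s))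

  Annihilates : ∀ {m} → ℕ → ℤ → Vec Carrier m → Set
  Annihilates k s c = ∀ t → t ℕ.< k → pair c δ (shift t s) ≡ 0#

  annihilates-linear : ∀ {m k s} r t {u v : Vec Carrier m} →
    Annihilates k s u → Annihilates k s v → Annihilates k s (r *ᵛ u +ᵛ t *ᵛ v)
  annihilates-linear r t {u} {v} hu hv i i<k = trans (pair-linear r t u v δ _) (linear-zero r t (hu i i<k) (hv i i<k))

  annihilates-∷ʳ-0 : ∀ {m k s} {c : Vec Carrier m} → Annihilates k s c → Annihilates k s (c ∷ʳ 0#)
  annihilates-∷ʳ-0 {c = c} h t t<k = trans (pair-∷ʳ-0 c δ _) (h t t<k)

  annihilates-0-∷ : ∀ {m k s} {c : Vec Carrier m} → Annihilates k (ℤ.suc (ℤ.suc s)) c → Annihilates k s (0# ∷ c)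
  annihilates-0-∷ {s = s} {c} h t t<k =
    trans (pair-0-∷ c δ _) (trans (cong (pair c δ) (sym (shift-suc² t s))) (h t t<k))

  annihilates-tail : ∀ {m k s} {c : Vec Carrier m} → Annihilates k s (0# ∷ c) → Annihilates k (ℤ.suc (ℤ.suc s)) c
  annihilates-tail {s = s} {c} h t t<k =
    trans (cong (pair c δ) (shift-suc² t s)) (trans (sym (pair-0-∷ c δ _)) (h t t<k))

  -- Dropping the last functional leaves the conditions for the line `p₀ p₂` of `vertex-suc`;
  -- dropping the first, in `annihilates-rest`, leaves those for the line `p₁ p₃`, based at `s + 1`.
  annihilates-init : ∀ {m k s} {c : Vec Carrier m} → Annihilates (suc k) s c → Annihilates k s c
  annihilates-init h t t<k = h t (ℕₚ.m<n⇒m<1+n t<k)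

  annihilates-rest : ∀ {m k s} {c : Vec Carrier m} → Annihilates (suc k) s c → Annihilates k (ℤ.suc s) c
  annihilates-rest h t t<k = h (suc t) (ℕ.s<s t<k)

  annihilates-last : ∀ {m k s} {c : Vec Carrier m} → Annihilates (suc k) s c → pair c δ (shift k s) ≡ 0#
  annihilates-last {k = k} h = h k (ℕₚ.n<1+n k)

  annihilates-extend : ∀ {m k s} {c : Vec Carrier m} →
    Annihilates k s c → pair c δ (shift k s) ≡ 0# → Annihilates (suc k) s c
  annihilates-extend h last t t<1+k with ℕₚ.m<1+n⇒m<n∨m≡n t<1+k
  ... | inj₁ t<k  = h t t<k
  ... | inj₂ refl = last

  -- The functional at `t = 0` is the hypothesis of `slide`. This is how a point is transferred
  -- between the bases `s` and `s + 1`.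
  combine-suc : ∀ {m k s} {c : Vec Carrier m} → Annihilates (suc k) s c → combine c A (ℤ.suc s) ≡ combine c A s
  combine-suc {c = c} h = slide c _ (h 0 (ℕ.s<s ℕ.z≤n))

  -- p represents the vertex of index s + 3k/2 of the k-th iterate, which is iterT k A (s + k) in the indexing
  -- of Defs; c is determined up to scale.
  Vertex : ℕ → ℤ → V3 → Set
  Vertex k s p = ∃ λ (c : Vec Carrier (suc k)) →
    Annihilates k s c × (∀ w → Annihilates k s w → ∃ λ r → w ≡ r *ᵛ c) × p ≡ combine c A s

  vertex-zero : ∀ s → Vertex 0 s (A s)
  vertex-zero s = 1# ∷ [] , (λ _ ()) ,
    (λ { (a ∷ []) _ → a , cong (_∷ []) (sym (*-identityʳ a)) }) ,
    sym (vec-≡ (unit _) (unit _) (unit _))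
    where
    unit : ∀ a → 1# * a + 0# ≡ a
    unit a = trans (+-identityʳ _) (*-identityˡ a)

  -- Elimination: a multiple of the padded `u` clears the leading coefficient of `w`, and what
  -- remains is a solution based at `s + 2`, hence a multiple of `v`. This needs a nonzero leading
  -- coefficient in `u`, which the distinctness of `p` and `q` provides.
  line-spans : ∀ {k s p q} ((u , _) : Vertex k s p) ((v , _) : Vertex k (ℤ.suc (ℤ.suc s)) q) →
    NonZero3 (cross p q) → ∀ w → Annihilates k s w →
    ∃ λ r → ∃ λ t → w ≡ r *ᵛ (u ∷ʳ 0#) +ᵛ t *ᵛ (0# ∷ v)
  line-spans {k} {s} {p} {q} (u₀ ∷ u , annU , _ , p≡) (v , _ , spanV , q≡) pq≢0 (w₀ ∷ w) annW with ≡0? u₀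
  ... | yes refl = contradiction pq≡0 pq≢0
    where
    -- With `u₀` zero, the tail of `u` solves the conditions based at `s + 2`; the zero at the end
    -- gives it the length of `v`.
    multiple : ∃ λ r → u ∷ʳ 0# ≡ r *ᵛ v
    multiple = spanV (u ∷ʳ 0#) (annihilates-∷ʳ-0 {c = u} (annihilates-tail {c = u} annU))
    r = proj₁ multiple

    p≡rq : p ≡ scale r q
    p≡rq = begin
      p                                   ≡⟨ p≡ ⟩
      combine (0# ∷ u) A s                ≡⟨ combine-0-∷ u A s ⟩
      combine u A (ℤ.suc (ℤ.suc s))       ≡⟨ combine-∷ʳ-0 u A _ ⟨
      combine (u ∷ʳ 0#) A (ℤ.suc (ℤ.suc s)) ≡⟨ cong (λ c → combine c A _) (proj₂ multiple) ⟩
      combine (r *ᵛ v) A (ℤ.suc (ℤ.suc s)) ≡⟨ combine-*ᵛ r v A _ ⟩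
      scale r (combine v A (ℤ.suc (ℤ.suc s))) ≡⟨ cong (scale r) q≡ ⟨
      scale r q                           ∎
      where open ≡-Reasoning

    pq≡0 : cross p q ≡ zero3
    pq≡0 = begin
      cross p q                          ≡⟨ cong (λ t → cross t q) p≡rq ⟩
      cross (scale r q) q                ≡⟨ cross-multiple r q ⟩
      zero3                              ∎
      where open ≡-Reasoning
  ... | no u₀≢0 with i , u₀i≡1 ← inverse u₀ u₀≢0 = r , t , (begin
    w₀ ∷ w
      ≡⟨ +ᵛ-cancel r U (w₀ ∷ w) ⟨
    r *ᵛ U +ᵛ (1# *ᵛ (w₀ ∷ w) +ᵛ (- r) *ᵛ U)
      ≡⟨ cong (λ c → r *ᵛ U +ᵛ c) (cong₂ _∷_ (trans head≡0 (sym (zeroʳ t))) (proj₂ multiple)) ⟩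
    r *ᵛ U +ᵛ t *ᵛ (0# ∷ v) ∎)
    where
    open ≡-Reasoning
    U = u₀ ∷ (u ∷ʳ 0#)
    -- The quotient `w₀ / u₀`, which makes the leading coefficient of the remainder vanish.
    r = w₀ * i
    rest = 1# *ᵛ w +ᵛ (- r) *ᵛ (u ∷ʳ 0#)

    head≡0 : 1# * w₀ + - r * u₀ ≡ 0#
    head≡0 = begin
      1# * w₀ + - (w₀ * i) * u₀ ≡⟨ solve 3 (λ a i u → :1 :* a :+ :- (a :* i) :* u := a :* (:1 :- u :* i)) refl w₀ i u₀ ⟩
      w₀ * (1# - u₀ * i)        ≡⟨ cong (λ z → w₀ * (1# - z)) u₀i≡1 ⟩
      w₀ * (1# - 1#)            ≡⟨ solve 1 (λ a → a :* (:1 :- :1) := :0) refl w₀ ⟩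
      0#                        ∎

    multiple : ∃ λ t → rest ≡ t *ᵛ v
    multiple = spanV rest (annihilates-tail {c = rest} (subst (λ h → Annihilates k s (h ∷ rest)) head≡0
      (annihilates-linear 1# (- r) {w₀ ∷ w} {U} annW (annihilates-∷ʳ-0 {c = u₀ ∷ u} annU))))
    t = proj₁ multiple

  -- The first `k` functionals leave the plane spanned by the padded vectors `U` and `V`, which
  -- corresponds to the line `p₀ p₂`. The additional functional cuts this plane down to the
  -- multiples of `w`, and the point `q` of `w` is shown to lie on both lines, so that it represents
  -- their meet.
  vertex-suc : ∀ {k s p₀ p₁ p₂ p₃} →
    Vertex k s p₀ → Vertex k (ℤ.suc s) p₁ → Vertex k (ℤ.suc (ℤ.suc s)) p₂ → Vertex k (ℤ.suc (ℤ.suc (ℤ.suc s))) p₃ →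
    NonZero3 (cross (cross p₀ p₂) (cross p₁ p₃)) → Vertex (suc k) s (cross (cross p₀ p₂) (cross p₁ p₃))
  vertex-suc {k} {s} {p₀} {p₁} {p₂} {p₃}
    V₀@(u , annU , _ , p₀≡) V₁@(u' , _ , spanU' , p₁≡) V₂@(v , annV , _ , p₂≡) V₃@(v' , _ , spanV' , p₃≡) meet≢0 =
    κ *ᵛ w , ann-κw , spans , trans meet≡ (trans (cong (scale κ) q≡) (sym (combine-*ᵛ κ w A s)))
    where
    open ≡-Reasoning
    L₀ = cross p₀ p₂
    L₁ = cross p₁ p₃
    a = pair u δ (shift k s)
    b = pair v δ (shift k (ℤ.suc (ℤ.suc s)))
    U = u ∷ʳ 0#
    V = 0# ∷ v
    -- The last functional takes the values `a` on `U` and `b` on `V`, so it vanishes on this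
    -- combination.
    w = b *ᵛ U +ᵛ (- a) *ᵛ V
    q = scale b p₀ ⊕ scale (- a) p₂

    L₀≢0 : NonZero3 L₀
    L₀≢0 L₀≡0 = meet≢0 (trans (cong (λ l → cross l L₁) L₀≡0) (cross-zeroˡ L₁))

    L₁≢0 : NonZero3 L₁
    L₁≢0 L₁≡0 = meet≢0 (trans (cong (cross L₀) L₁≡0) (cross-zeroʳ L₀))

    annU' : Annihilates k s U
    annU' = annihilates-∷ʳ-0 {c = u} annU

    annV' : Annihilates k s V
    annV' = annihilates-0-∷ {c = v} annV

    pairU : pair U δ (shift k s) ≡ a
    pairU = pair-∷ʳ-0 u δ _

    pairV : pair V δ (shift k s) ≡ b
    pairV = trans (pair-0-∷ v δ _) (cong (pair v δ) (sym (shift-suc² k s)))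

    combination : ∀ r t → combine (r *ᵛ U +ᵛ t *ᵛ V) A s ≡ scale r p₀ ⊕ scale t p₂
    combination r t = trans (combine-linear r t U V A s) (cong₂ (λ x y → scale r x ⊕ scale t y)
      (trans (combine-∷ʳ-0 u A s) (sym p₀≡)) (trans (combine-0-∷ v A s) (sym p₂≡)))

    ann-w : Annihilates (suc k) s w
    ann-w = annihilates-extend {c = w} (annihilates-linear b (- a) {U} {V} annU' annV') (begin
      pair w δ (shift k s)
        ≡⟨ pair-linear b (- a) U V δ (shift k s) ⟩
      b * pair U δ (shift k s) + - a * pair V δ (shift k s)
        ≡⟨ cong₂ (λ x y → b * x + - a * y) pairU pairV ⟩
      b * a + - a * b
        ≡⟨ solve 2 (λ a b → b :* a :+ (:- a) :* b := :0) refl a b ⟩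
      0# ∎)

    q≡ : q ≡ combine w A s
    q≡ = sym (combination b (- a))

    -- If u and v also annihilate the last functional, they are multiples of u' and v', and the two lines coincide.
    a≡0×b≡0⇒⊥ : ¬ (a ≡ 0# × b ≡ 0#)
    a≡0×b≡0⇒⊥ (a≡0 , b≡0) = meet≢0 (begin
      cross L₀ L₁
        ≡⟨ cong (λ l → cross l L₁) (trans (cong₂ cross p₀≡rp₁ p₂≡tp₃) (cross-scale r t p₁ p₃)) ⟩
      cross (scale (r * t) L₁) L₁
        ≡⟨ cross-multiple (r * t) L₁ ⟩
      zero3 ∎)
      where
      annU⁺ : Annihilates (suc k) s u
      annU⁺ = annihilates-extend {c = u} annU a≡0
      annV⁺ : Annihilates (suc k) (ℤ.suc (ℤ.suc s)) v
      annV⁺ = annihilates-extend {c = v} annV b≡0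
      multipleU = spanU' u (annihilates-rest {c = u} annU⁺)
      multipleV = spanV' v (annihilates-rest {c = v} annV⁺)
      r = proj₁ multipleU
      t = proj₁ multipleV
      p₀≡rp₁ : p₀ ≡ scale r p₁
      p₀≡rp₁ = begin
        p₀                            ≡⟨ p₀≡ ⟩
        combine u A s                 ≡⟨ combine-suc {c = u} annU⁺ ⟨
        combine u A (ℤ.suc s)         ≡⟨ cong (λ c → combine c A _) (proj₂ multipleU) ⟩
        combine (r *ᵛ u') A (ℤ.suc s) ≡⟨ combine-*ᵛ r u' A _ ⟩
        scale r (combine u' A (ℤ.suc s)) ≡⟨ cong (scale r) p₁≡ ⟨
        scale r p₁                    ∎
      p₂≡tp₃ : p₂ ≡ scale t p₃
      p₂≡tp₃ = begin
        p₂                            ≡⟨ p₂≡ ⟩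
        combine v A _                 ≡⟨ combine-suc {c = v} annV⁺ ⟨
        combine v A _                 ≡⟨ cong (λ c → combine c A _) (proj₂ multipleV) ⟩
        combine (t *ᵛ v') A _         ≡⟨ combine-*ᵛ t v' A _ ⟩
        scale t (combine v' A _)      ≡⟨ cong (scale t) p₃≡ ⟨
        scale t p₃                    ∎

    q≢0 : NonZero3 q
    q≢0 q≡0 = a≡0×b≡0⇒⊥ (trans (solve 1 (λ a → a := (:- :1) :* (:- a)) refl a)
      (trans (cong (- 1# *_) (proj₂ coefficients≡0)) (zeroʳ _)) , proj₁ coefficients≡0)
      where
      coefficients≡0 : b ≡ 0# × - a ≡ 0#
      coefficients≡0 = independent L₀≢0 q≡0

    -- Seen from the base `s + 1`, `w` satisfies the conditions for the line `p₁ p₃`, and its point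
    -- is unchanged by `combine-suc`.
    q∈L₁ : dot L₁ q ≡ 0#
    q∈L₁ = trans (cong (dot L₁) q-combination) (incident-combination r t p₁ p₃)
      where
      coordinates = line-spans V₁ V₃ L₁≢0 w (annihilates-rest {c = w} ann-w)
      r = proj₁ coordinates
      t = proj₁ (proj₂ coordinates)
      q-combination : q ≡ scale r p₁ ⊕ scale t p₃
      q-combination = begin
        q                          ≡⟨ q≡ ⟩
        combine w A s              ≡⟨ combine-suc {c = w} ann-w ⟨
        combine w A (ℤ.suc s)      ≡⟨ cong (λ c → combine c A _) (proj₂ (proj₂ coordinates)) ⟩
        combine (r *ᵛ (u' ∷ʳ 0#) +ᵛ t *ᵛ (0# ∷ v')) A (ℤ.suc s)
          ≡⟨ combine-linear r t (u' ∷ʳ 0#) (0# ∷ v') A _ ⟩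
        scale r (combine (u' ∷ʳ 0#) A (ℤ.suc s)) ⊕ scale t (combine (0# ∷ v') A (ℤ.suc s))
          ≡⟨ cong₂ (λ x y → scale r x ⊕ scale t y)
               (trans (combine-∷ʳ-0 u' A _) (sym p₁≡)) (trans (combine-0-∷ v' A _) (sym p₃≡)) ⟩
        scale r p₁ ⊕ scale t p₃    ∎

    -- Both lines contain the nonzero `q`, so their cross product is a multiple of it.
    proportional = cross≡0⇒multiple q≢0 (cross-meet L₀ L₁ q (incident-combination b (- a) p₀ p₂) q∈L₁)
    κ = proj₁ proportional
    meet≡ : cross L₀ L₁ ≡ scale κ q
    meet≡ = proj₂ proportional

    κ≢0 : κ ≢ 0#
    κ≢0 κ≡0 = meet≢0 (trans meet≡ (trans (cong (λ r → scale r q) κ≡0) (scale-zero q)))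

    ann-κw : Annihilates (suc k) s (κ *ᵛ w)
    ann-κw t t<k = trans (pair-*ᵛ κ w δ _) (trans (cong (κ *_) (ann-w t t<k)) (zeroʳ κ))

    -- Any solution lies in the plane of `U` and `V`; the last functional then fixes the ratio of
    -- its two coordinates.
    spans-w : ∀ x → Annihilates (suc k) s x → ∃ λ r → x ≡ r *ᵛ w
    spans-w x annX = combine-multiple (line-spans V₀ V₂ L₀≢0 x (annihilates-init {c = x} annX))
      where
      combine-multiple : (∃ λ r → ∃ λ t → x ≡ r *ᵛ U +ᵛ t *ᵛ V) → ∃ λ r → x ≡ r *ᵛ w
      combine-multiple (r , t , x≡) = proj₁ multiple , (begin
        x                       ≡⟨ x≡ ⟩
        r *ᵛ U +ᵛ t *ᵛ V        ≡⟨ cong₂ (λ y z → y *ᵛ U +ᵛ z *ᵛ V) (proj₁ (proj₂ multiple)) (proj₂ (proj₂ multiple)) ⟨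
        _                       ≡⟨ *ᵛ-combination (proj₁ multiple) b (- a) U V ⟨
        proj₁ multiple *ᵛ w     ∎)
        where
        multiple = kernel-multiple a≡0×b≡0⇒⊥ r t (begin
          r * a + t * b ≡⟨ cong₂ (λ y z → r * y + t * z) pairU pairV ⟨
          r * pair U δ (shift k s) + t * pair V δ (shift k s) ≡⟨ pair-linear r t U V δ _ ⟨
          pair (r *ᵛ U +ᵛ t *ᵛ V) δ (shift k s) ≡⟨ cong (λ c → pair c δ _) x≡ ⟨
          pair x δ (shift k s) ≡⟨ annihilates-last {c = x} annX ⟩
          0# ∎)

    spans : ∀ x → Annihilates (suc k) s x → ∃ λ r → x ≡ r *ᵛ (κ *ᵛ w)
    spans x annX = multiple-of-scaled κ≢0 (spans-w x annX)

-- Axis-aligned polygons satisfy the sliding property.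

module AxisAlignedPolygon (R : RealField) (A : ℤ → Geometry.R2 R) (aligned : Geometry.AxisAligned R A) where
  open Geometry R
  open Field R
  open Vectors R

  P : ℤ → V3
  P i = lift (A i)

  X Y : ℤ → Carrier
  X i = proj₁ (A i)
  Y i = proj₂ (A i)

  -- One of the two summands vanishes, so this is the signed length of the side from A i to A (i + 1).
  δ : ℤ → Carrier
  δ i = (X (ℤ.suc i) - X i) + (Y (ℤ.suc i) - Y i)

  pair-δ : ∀ {m} (c : Vec Carrier m) s →
    pair c δ s ≡ (pair c X (ℤ.suc s) - pair c X s) + (pair c Y (ℤ.suc s) - pair c Y s)
  pair-δ []      s = solve 0 (:0 := (:0 :- :0) :+ (:0 :- :0)) refl
  pair-δ (a ∷ c) s = trans (cong (a * δ s +_) (pair-δ c _))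
    (solve 9 (λ a x' x y' y p' p q' q →
      a :* ((x' :- x) :+ (y' :- y)) :+ ((p' :- p) :+ (q' :- q))
      := ((a :* x' :+ p') :- (a :* x :+ p)) :+ ((a :* y' :+ q') :- (a :* y :+ q))) refl
      a (X (ℤ.suc s)) (X s) (Y (ℤ.suc s)) (Y s)
      (pair c X _) (pair c X _) (pair c Y _) (pair c Y _))

  Flat : (ℤ → Carrier) → ℤ → Set
  Flat f s = ∀ t → f (ℤ.suc (advance t s)) ≡ f (advance t s)

  pair-flat : ∀ {m f s} (c : Vec Carrier m) → Flat f s → pair c f (ℤ.suc s) ≡ pair c f s
  pair-flat []      flat = refl
  pair-flat (a ∷ c) flat = cong₂ (λ g p → a * g + p) (flat 0) (pair-flat c (λ t → flat (suc t)))

  -- Here `g` enumerates the indices of one parity, so that even and odd sides share one induction: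
  -- two steps of the index are one step of `q`.
  flat-along : ∀ f (g : ℤ → ℤ) → (∀ q → ℤ.suc (ℤ.suc (g q)) ≡ g (ℤ.suc q)) →
    (∀ q → f (g q) ≡ f (g q ℤ.+ ℤ.1ℤ)) → ∀ q → Flat f (g q)
  flat-along f g g-suc f-flat q zero    = trans (cong f (ℤₚ.+-comm ℤ.1ℤ (g q))) (sym (f-flat q))
  flat-along f g g-suc f-flat q (suc t) =
    subst (λ s → f (ℤ.suc (advance t s)) ≡ f (advance t s)) (sym (g-suc q)) (flat-along f g g-suc f-flat (ℤ.suc q) t)

  flat : ∀ s → Flat X s ⊎ Flat Y s
  flat s = choose (s %ℕ 2) (n%ℕd<d s 2) (a≡a%ℕn+[a/ℕn]*n s 2) aligned
    where
    q = s /ℕ 2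
    double-suc : ∀ q → ℤ.suc (ℤ.suc (ℤ.+ 2 ℤ.* q)) ≡ ℤ.+ 2 ℤ.* ℤ.suc q
    double-suc q = ℤsolve 1 (λ q → ℤcon ℤ.1ℤ ℤ:+ (ℤcon ℤ.1ℤ ℤ:+ ℤcon (ℤ.+ 2) ℤ:* q) ℤ:= ℤcon (ℤ.+ 2) ℤ:* (ℤcon ℤ.1ℤ ℤ:+ q)) refl q
    odd-suc : ∀ q → ℤ.suc (ℤ.suc (ℤ.+ 2 ℤ.* q ℤ.+ ℤ.1ℤ)) ≡ ℤ.+ 2 ℤ.* ℤ.suc q ℤ.+ ℤ.1ℤ
    odd-suc q = ℤsolve 1 (λ q → ℤcon ℤ.1ℤ ℤ:+ (ℤcon ℤ.1ℤ ℤ:+ (ℤcon (ℤ.+ 2) ℤ:* q ℤ:+ ℤcon ℤ.1ℤ)) ℤ:= ℤcon (ℤ.+ 2) ℤ:* (ℤcon ℤ.1ℤ ℤ:+ q) ℤ:+ ℤcon ℤ.1ℤ) refl q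

    even : s ≡ ℤ.+ 0 ℤ.+ q ℤ.* ℤ.+ 2 → s ≡ ℤ.+ 2 ℤ.* q
    even eq = trans eq (trans (ℤₚ.+-identityˡ _) (ℤₚ.*-comm q (ℤ.+ 2)))
    odd : s ≡ ℤ.+ 1 ℤ.+ q ℤ.* ℤ.+ 2 → s ≡ ℤ.+ 2 ℤ.* q ℤ.+ ℤ.1ℤ
    odd eq = trans eq (trans (ℤₚ.+-comm _ (q ℤ.* ℤ.+ 2)) (cong (ℤ._+ ℤ.1ℤ) (ℤₚ.*-comm q (ℤ.+ 2))))

    flat-even : ∀ f → (∀ j → f (ℤ.+ 2 ℤ.* j) ≡ f (ℤ.+ 2 ℤ.* j ℤ.+ ℤ.1ℤ)) → s ≡ ℤ.+ 0 ℤ.+ q ℤ.* ℤ.+ 2 → Flat f s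
    flat-even f h eq = subst (Flat f) (sym (even eq)) (flat-along f (ℤ.+ 2 ℤ.*_) double-suc h q)
    flat-odd : ∀ f → (∀ j → f (ℤ.+ 2 ℤ.* j ℤ.+ ℤ.1ℤ) ≡ f (ℤ.+ 2 ℤ.* j ℤ.+ ℤ.1ℤ ℤ.+ ℤ.1ℤ)) →
      s ≡ ℤ.+ 1 ℤ.+ q ℤ.* ℤ.+ 2 → Flat f s
    flat-odd f h eq = subst (Flat f) (sym (odd eq)) (flat-along f (λ q → ℤ.+ 2 ℤ.* q ℤ.+ ℤ.1ℤ) odd-suc h q)

    choose : ∀ r → r ℕ.< 2 → s ≡ ℤ.+ r ℤ.+ q ℤ.* ℤ.+ 2 → AxisAligned A → Flat X s ⊎ Flat Y s
    choose 0 _ eq (inj₁ h) = inj₂ (flat-even Y (λ j → proj₁ (h j)) eq)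
    choose 0 _ eq (inj₂ h) = inj₁ (flat-even X (λ j → proj₁ (h j)) eq)
    choose 1 _ eq (inj₁ h) = inj₁ (flat-odd X (λ j → proj₂ (h j)) eq)
    choose 1 _ eq (inj₂ h) = inj₂ (flat-odd Y (λ j → proj₂ (h j)) eq)
    choose (suc (suc _)) (ℕ.s≤s (ℕ.s≤s ())) _ _

  -- The coordinate that is constant along these parallel sides agrees termwise. By `pair-δ` the
  -- hypothesis then concerns the other coordinate alone. The third coordinate is constantly 1.
  slide : ∀ {m} (c : Vec Carrier m) s → pair c δ s ≡ 0# → combine c P (ℤ.suc s) ≡ combine c P s
  slide c s c⊥δ = vec-≡ (proj₁ (coordinates (flat s))) (proj₂ (coordinates (flat s))) (pair-flat c (λ _ → refl))
    where
    open ≡-Reasoning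
    dX = pair c X (ℤ.suc s) - pair c X s
    dY = pair c Y (ℤ.suc s) - pair c Y s
    difference≡0 : ∀ {x y} → x ≡ y → x - y ≡ 0#
    difference≡0 {x} refl = -‿inverseʳ x

    coordinates : Flat X s ⊎ Flat Y s → pair c X (ℤ.suc s) ≡ pair c X s × pair c Y (ℤ.suc s) ≡ pair c Y s
    coordinates (inj₁ flatX) = pair-flat c flatX , x-y≡0⇒x≡y _ _ (begin
      dY        ≡⟨ +-identityˡ dY ⟨
      0# + dY   ≡⟨ cong (_+ dY) (difference≡0 (pair-flat c flatX)) ⟨
      dX + dY   ≡⟨ pair-δ c s ⟨
      pair c δ s ≡⟨ c⊥δ ⟩
      0# ∎)
    coordinates (inj₂ flatY) = x-y≡0⇒x≡y _ _ (begin
      dX        ≡⟨ +-identityʳ dX ⟨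
      dX + 0#   ≡⟨ cong (dX +_) (difference≡0 (pair-flat c flatY)) ⟨
      dX + dY   ≡⟨ pair-δ c s ⟨
      pair c δ s ≡⟨ c⊥δ ⟩
      0# ∎) , pair-flat c flatY

  open Iteration R P δ slide

  vertices : ∀ k → (∀ j → j ℕ.≤ k → ∀ i → NonZero3 (iterT j P i)) → ∀ s → Vertex k s (iterT k P (s ℤ.+ ℤ.+ k))
  vertices zero    defined s = subst (λ i → Vertex 0 s (P i)) (sym (ℤₚ.+-identityʳ s)) (vertex-zero s)
  -- `pentagram` at `s + (k + 1)` uses the indices from `s + k` to `s + k + 3`, that is, the bases
  -- from `s` to `s + 3`.
  vertices (suc k) defined s = vertex-suc
    (at s (ℤsolve 2 (λ s k → s ℤ:+ k ℤ:= s ℤ:+ (ℤcon ℤ.1ℤ ℤ:+ k) ℤ:- ℤcon ℤ.1ℤ) refl s (ℤ.+ k)))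
    (at _ (ℤsolve 2 (λ s k → ℤcon ℤ.1ℤ ℤ:+ s ℤ:+ k ℤ:= s ℤ:+ (ℤcon ℤ.1ℤ ℤ:+ k)) refl s (ℤ.+ k)))
    (at _ (ℤsolve 2 (λ s k → ℤcon ℤ.1ℤ ℤ:+ (ℤcon ℤ.1ℤ ℤ:+ s) ℤ:+ k ℤ:= s ℤ:+ (ℤcon ℤ.1ℤ ℤ:+ k) ℤ:+ ℤcon ℤ.1ℤ) refl s (ℤ.+ k)))
    (at _ (ℤsolve 2 (λ s k → ℤcon ℤ.1ℤ ℤ:+ (ℤcon ℤ.1ℤ ℤ:+ (ℤcon ℤ.1ℤ ℤ:+ s)) ℤ:+ k ℤ:= s ℤ:+ (ℤcon ℤ.1ℤ ℤ:+ k) ℤ:+ ℤcon (ℤ.+ 2)) refl s (ℤ.+ k)))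
    (defined (suc k) ℕₚ.≤-refl (s ℤ.+ ℤ.+ suc k))
    where
    at : ∀ s {i} → s ℤ.+ ℤ.+ k ≡ i → Vertex k s (iterT k P i)
    at s refl = vertices k (λ j j≤k → defined j (ℕₚ.m≤n⇒m≤1+n j≤k)) s

  -- Twisted periodicity and consecutive vertices of one parity.

  module Periodic (r : Carrier) (r≢0 : r ≢ 0#) (C : V3) (n : ℕ)
    (twist : ∀ i → P (i ℤ.+ ℤ.+ (2 ℕ.* suc n)) ≡ scale r (P i) ⊕ C) where

    period : ∀ i → advance (suc n) i ≡ i ℤ.+ ℤ.+ (2 ℕ.* suc n)
    period = go (suc n)
      where
      go : ∀ m i → advance m i ≡ i ℤ.+ ℤ.+ (2 ℕ.* m)
      go zero    i = sym (ℤₚ.+-identityʳ i)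
      go (suc m) i = trans (go m _) (trans
        (ℤsolve 2 (λ i k → ℤcon ℤ.1ℤ ℤ:+ (ℤcon ℤ.1ℤ ℤ:+ i) ℤ:+ k ℤ:= i ℤ:+ (ℤcon (ℤ.+ 2) ℤ:+ k)) refl i (ℤ.+ (2 ℕ.* m)))
        (cong (λ k → i ℤ.+ ℤ.+ k) (sym (ℕₚ.*-suc 2 m))))

    twist-advance : ∀ i → P (advance (suc n) i) ≡ scale r (P i) ⊕ C
    twist-advance i = trans (cong P (period i)) (twist i)

    -- The translation part cancels in differences. The summand `0#` is the offset `d` expected by
    -- `pair-rotate`.
    δ-twist : ∀ i → δ (advance (suc n) i) ≡ r * δ i + 0#
    δ-twist i = begin
      δ (advance (suc n) i)
        ≡⟨ cong₂ (λ u v → (V3.x u - V3.x v) + (V3.y u - V3.y v)) (trans (cong P shifted) (twist-advance (ℤ.suc i))) (twist-advance i) ⟩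
      (r * X (ℤ.suc i) + V3.x C - (r * X i + V3.x C)) + (r * Y (ℤ.suc i) + V3.y C - (r * Y i + V3.y C))
        ≡⟨ solve 7 (λ r x' x y' y c d → (r :* x' :+ c :- (r :* x :+ c)) :+ (r :* y' :+ d :- (r :* y :+ d))
                                     := r :* ((x' :- x) :+ (y' :- y)) :+ :0) refl r _ _ _ _ _ _ ⟩
      r * δ i + 0# ∎
      where
      open ≡-Reasoning
      shifted : ℤ.suc (advance (suc n) i) ≡ advance (suc n) (ℤ.suc i)
      shifted = trans (cong ℤ.suc (period i)) (trans (sym (ℤₚ.+-assoc ℤ.1ℤ i _)) (sym (period (ℤ.suc i))))

    -- Moving the window by two drops the term at `s` and adds one at `s + 2(n + 1)`, a full period
    -- later. There `f-twist` reproduces the dropped term, scaled by `r` and offset by `d`.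
    pair-rotate : ∀ a (c : Vec Carrier n) f d s → f (advance (suc n) s) ≡ r * f s + d →
      pair (r *ᵛ c ∷ʳ a) f (ℤ.suc (ℤ.suc s)) ≡ r * pair (a ∷ c) f s + a * d
    pair-rotate a c f d s f-twist = begin
      pair (r *ᵛ c ∷ʳ a) f s+2
        ≡⟨ pair-∷ʳ (r *ᵛ c) a f s+2 ⟩
      pair (r *ᵛ c) f s+2 + a * f (advance (suc n) s)
        ≡⟨ cong₂ (λ p g → p + a * g) (pair-*ᵛ r c f s+2) f-twist ⟩
      r * pair c f s+2 + a * (r * f s + d)
        ≡⟨ solve 5 (λ r p a g d → r :* p :+ a :* (r :* g :+ d) := r :* (a :* g :+ p) :+ a :* d) refl r _ a (f s) d ⟩
      r * pair (a ∷ c) f s + a * d ∎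
      where
      open ≡-Reasoning
      s+2 = ℤ.suc (ℤ.suc s)

    -- Serves to exclude `t = 0` in `next-vertex`: as `r` is nonzero, the rotated coefficients
    -- vanish only together with the original ones.
    rotate≡0 : ∀ {m} a (c : Vec Carrier m) v → r *ᵛ c ∷ʳ a ≡ 0# *ᵛ v → a ≡ 0# × (∀ f s → pair c f s ≡ 0#)
    rotate≡0 a []      (y ∷ []) eq = trans (proj₁ (Vecₚ.∷-injective eq)) (zeroˡ y) , λ _ _ → refl
    rotate≡0 a (b ∷ c) (y ∷ v)  eq with rotate≡0 a c v (proj₂ (Vecₚ.∷-injective eq))
    ... | a≡0 , c≡0 = a≡0 , λ f s → trans (cong₂ (λ z p → z * f s + p)
            (cancel-*ˡ r≢0 (trans (proj₁ (Vecₚ.∷-injective eq)) (zeroˡ y))) (c≡0 f _))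
            (trans (+-identityʳ _) (zeroˡ (f s)))

    -- Over one period the coefficients of the next vertex of the same parity are the rotated ones.
    next-vertex : ∀ {s p q} → Vertex n s p → Vertex n (ℤ.suc (ℤ.suc s)) q → NonZero3 p →
      ∃ λ t → ∃ λ a → t ≢ 0# × scale t q ≡ scale r p ⊕ scale a C
    next-vertex {s} {p} {q} (a ∷ c , annU , _ , p≡) (v , _ , spanV , q≡) p≢0 =
      t , a , t≢0 , (begin
        scale t q                        ≡⟨ cong (scale t) q≡ ⟩
        scale t (combine v P s+2)        ≡⟨ combine-*ᵛ t v P s+2 ⟨
        combine (t *ᵛ v) P s+2           ≡⟨ cong (λ c → combine c P s+2) w≡tv ⟨
        combine w P s+2                  ≡⟨ vec-≡ (pair-rotate a c X _ s (cong V3.x (twist-advance s)))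
                                                  (pair-rotate a c Y _ s (cong V3.y (twist-advance s)))
                                                  (pair-rotate a c _ _ s (cong V3.z (twist-advance s))) ⟩
        scale r (combine (a ∷ c) P s) ⊕ scale a C ≡⟨ cong (λ x → scale r x ⊕ scale a C) p≡ ⟨
        scale r p ⊕ scale a C            ∎)
      where
      open ≡-Reasoning
      s+2 = ℤ.suc (ℤ.suc s)
      w = r *ᵛ c ∷ʳ a

      ann-w : Annihilates n s+2 w
      ann-w i i<n = begin
        pair w δ (shift i s+2)                       ≡⟨ cong (pair w δ) (shift-suc² i s) ⟩
        pair w δ (ℤ.suc (ℤ.suc (shift i s)))         ≡⟨ pair-rotate a c δ 0# _ (δ-twist (shift i s)) ⟩
        r * pair (a ∷ c) δ (shift i s) + a * 0#      ≡⟨ linear-zero r a (annU i i<n) refl ⟩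
        0#                                           ∎

      t = proj₁ (spanV w ann-w)
      w≡tv : w ≡ t *ᵛ v
      w≡tv = proj₂ (spanV w ann-w)

      t≢0 : t ≢ 0#
      -- Otherwise every coefficient of `p` would vanish, and `p` with them.
      t≢0 t≡0 = p≢0 (trans p≡ (vec-≡ (vanish X s) (vanish Y s) (vanish _ s)))
        where
        zeros = rotate≡0 a c v (trans w≡tv (cong (_*ᵛ v) t≡0))
        vanish : ∀ f s → pair (a ∷ c) f s ≡ 0#
        vanish f s = trans (cong₂ (λ z p → z * f s + p) (proj₁ zeros) (proj₂ zeros f _))
          (trans (+-identityʳ _) (zeroˡ (f s)))

-- Transformations fixing the line at infinity pointwise.

module Homothety (R : RealField) where
  open Geometry R
  open Field R
  open Vectors R

  module _ (a b c d e f g h i : Carrier) (fixes : FixesInfinity (mat (vec a b c) (vec d e f) (vec g h i))) where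

    private
      1≢0 : 1# ≢ 0#
      1≢0 1≡0 = 0≢1 (sym 1≡0)
      at10 = proj₂ (proj₂ (fixes 1# 0# (λ eq → 1≢0 (cong V3.x eq))))
      at01 = proj₂ (proj₂ (fixes 0# 1# (λ eq → 1≢0 (cong V3.y eq))))
      at11 = proj₂ (proj₂ (fixes 1# 1# (λ eq → 1≢0 (cong V3.x eq))))

      first : ∀ x y z → x * 1# + y * 0# + z * 0# ≡ x
      first = solve 3 (λ x y z → x :* :1 :+ y :* :0 :+ z :* :0 := x) refl
      second : ∀ x y z → x * 0# + y * 1# + z * 0# ≡ y
      second = solve 3 (λ x y z → x :* :0 :+ y :* :1 :+ z :* :0 := y) refl
      both : ∀ x y z → x * 1# + y * 1# + z * 0# ≡ x + y
      both = solve 3 (λ x y z → x :* :1 :+ y :* :1 :+ z :* :0 := x :+ y) refl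

    -- Fixing the directions of the two axes clears the off-diagonal entries of the first two
    -- columns.
    d≡0 : d ≡ 0#
    d≡0 = trans (sym (first d e f)) (trans (cong V3.y at10) (zeroʳ _))
    g≡0 : g ≡ 0#
    g≡0 = trans (sym (first g h i)) (trans (cong V3.z at10) (zeroʳ _))
    b≡0 : b ≡ 0#
    b≡0 = trans (sym (second a b c)) (trans (cong V3.x at01) (zeroʳ _))
    h≡0 : h ≡ 0#
    h≡0 = trans (sym (second g h i)) (trans (cong V3.z at01) (zeroʳ _))

    -- The image `(a + b , d + e , _)` of the diagonal direction has equal first coordinates.
    e≡a : e ≡ a
    e≡a = begin
      e       ≡⟨ +-identityˡ e ⟨
      0# + e  ≡⟨ cong (_+ e) d≡0 ⟨
      d + e   ≡⟨ both d e f ⟨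
      _       ≡⟨ cong V3.y at11 ⟩
      _       ≡⟨ cong V3.x at11 ⟨
      _       ≡⟨ both a b c ⟩
      a + b   ≡⟨ cong (a +_) b≡0 ⟩
      a + 0#  ≡⟨ +-identityʳ a ⟩
      a       ∎
      where open ≡-Reasoning

  -- The last row of the matrix is now `(0 , 0 , i)`. Since lifts have third coordinate 1, the
  -- proportionality factor at every index is inverse to `i`, so one factor `κ` serves for all
  -- indices.
  homothety : ∀ {M} → IsProjectiveTransformation M → FixesInfinity M → ∀ {A n} → Twisted n M A →
    ∃ λ r → ∃ λ C → r ≢ 0# × (∀ j → lift (A (j ℤ.+ ℤ.+ (2 ℕ.* n))) ≡ scale r (lift (A j)) ⊕ C)
  homothety {mat (vec a b c) (vec d e f) (vec g h i)} det≢0 fixes {A} {n} twisted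
    with refl ← d≡0 a b c d e f g h i fixes
    with refl ← g≡0 a b c d e f g h i fixes
    with refl ← b≡0 a b c d e f g h i fixes
    with refl ← h≡0 a b c d e f g h i fixes
    with refl ← e≡a a b c d e f g h i fixes
    -- The entry `1# - r` restores the third coordinate 1. This vector represents the centre of the
    -- homothety if `r` differs from 1, and is the translation vector otherwise.
    = r , vec (κ * c) (κ * f) (1# - r) , r≢0 , moves
    where
    open ≡-Reasoning
    scaling : ℤ → Carrier
    scaling j = proj₁ (twisted j)
    moved : ∀ j → lift (A (j ℤ.+ ℤ.+ (2 ℕ.* n))) ≡ scale (scaling j) (apply _ (lift (A j)))
    moved j = proj₂ (proj₂ (twisted j))
    κ = scaling ℤ.0ℤ
    r = κ * a

    scaling-inverse : ∀ j → scaling j * i ≡ 1#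
    scaling-inverse j = trans
      (solve 4 (λ k i x y → k :* i := k :* (:0 :* x :+ :0 :* y :+ i :* :1)) refl (scaling j) i (proj₁ (A j)) (proj₂ (A j)))
      (sym (cong V3.z (moved j)))

    scaling-constant : ∀ j → scaling j ≡ κ
    scaling-constant j = begin
      k             ≡⟨ *-identityʳ k ⟨
      k * 1#        ≡⟨ cong (k *_) (scaling-inverse ℤ.0ℤ) ⟨
      k * (κ * i)   ≡⟨ solve 3 (λ k l i → k :* (l :* i) := l :* (k :* i)) refl k κ i ⟩
      κ * (k * i)   ≡⟨ cong (κ *_) (scaling-inverse j) ⟩
      κ * 1#        ≡⟨ *-identityʳ κ ⟩
      κ             ∎
      where k = scaling j

    κ≢0 : κ ≢ 0#
    κ≢0 κ≡0 = 0≢1 (trans (sym (zeroˡ i)) (trans (cong (_* i) (sym κ≡0)) (scaling-inverse ℤ.0ℤ)))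

    r≢0 : r ≢ 0#
    -- The determinant is now `a * (a * i)`.
    r≢0 r≡0 = det≢0 (trans
      (solve 4 (λ a c f i → a :* (a :* i :- f :* :0) :+ :0 :* (f :* :0 :- :0 :* i) :+ c :* (:0 :* :0 :- a :* :0)
                         := a :* (a :* i)) refl a c f i)
      (trans (cong (_* (a * i)) (cancel-*ˡ κ≢0 r≡0)) (zeroˡ _)))

    moves : ∀ j → lift (A (j ℤ.+ ℤ.+ (2 ℕ.* n))) ≡ scale r (lift (A j)) ⊕ vec (κ * c) (κ * f) (1# - r)
    moves j = trans (moved j) (trans (cong (λ k → scale k (apply _ (lift (A j)))) (scaling-constant j)) (vec-≡
      (solve 5 (λ k a c x y → k :* (a :* x :+ :0 :* y :+ c :* :1) := k :* a :* x :+ k :* c) refl κ a c X Y)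
      (solve 5 (λ k a f x y → k :* (:0 :* x :+ a :* y :+ f :* :1) := k :* a :* y :+ k :* f) refl κ a f X Y)
      (trans (solve 4 (λ k i x y → k :* (:0 :* x :+ :0 :* y :+ i :* :1) := k :* i) refl κ i X Y)
        (trans (scaling-inverse ℤ.0ℤ) (solve 1 (λ r → :1 := r :* :1 :+ (:1 :- r)) refl r)))))
      where
      X = proj₁ (A j)
      Y = proj₂ (A j)

-- Orbits on a line through a fixed centre.

module Collinearity (R : RealField) where
  open Geometry R
  open Field R
  open Vectors R

  ℤ-induction : (Q : ℤ → Set) → Q ℤ.0ℤ → (∀ m → Q m → Q (ℤ.suc m)) → (∀ m → Q (ℤ.suc m) → Q m) → ∀ m → Q m
  ℤ-induction Q q₀ up down (ℤ.+ zero)          = q₀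
  ℤ-induction Q q₀ up down (ℤ.+ suc n)         = up (ℤ.+ n) (ℤ-induction Q q₀ up down (ℤ.+ n))
  ℤ-induction Q q₀ up down ℤ.-[1+ zero ]       = down ℤ.-[1+ zero ] q₀
  ℤ-induction Q q₀ up down ℤ.-[1+ suc n ]      = down ℤ.-[1+ suc n ] (ℤ-induction Q q₀ up down ℤ.-[1+ n ])

  -- The line joins `B i₀` to `C`. As `C` lies on it and `t` and `r` are nonzero, incidence passes
  -- from each vertex to the next of its parity and back.
  orbit-collinear : ∀ {r C} (B : ℤ → V3) → r ≢ 0# →
    (∀ i → ∃ λ t → ∃ λ a → t ≢ 0# × scale t (B (i ℤ.+ ℤ.+ 2)) ≡ scale r (B i) ⊕ scale a C) →
    (∀ i → NonZero3 (cross (B i) (B (i ℤ.+ ℤ.+ 2)))) →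
    ∀ i₀ → ∃ λ L → NonZero3 L × (∀ m → Incident L (B (i₀ ℤ.+ ℤ.+ 2 ℤ.* m)))
  orbit-collinear {r} {C} B r≢0 next distinct i₀ = L , L≢0 , ℤ-induction Q (base _ (ℤₚ.+-identityʳ i₀)) up down
    where
    open ≡-Reasoning
    L = cross (B i₀) C
    Q : ℤ → Set
    Q m = Incident L (B (i₀ ℤ.+ ℤ.+ 2 ℤ.* m))

    L≢0 : NonZero3 L
    -- Crossing the relation for `i₀` with `B i₀` gives `t` (B i₀ × B (i₀ + 2)) = `a` L, whose left
    -- side is nonzero.
    L≢0 L≡0 = let (t , a , t≢0 , tB≡) = next i₀ in t≢0 (scale≡0⇒≡0 (distinct i₀) (begin
      scale t (cross (B i₀) (B (i₀ ℤ.+ ℤ.+ 2)))             ≡⟨ cross-combinationʳ 0# t (B i₀) _ ⟨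
      cross (B i₀) (scale 0# (B i₀) ⊕ scale t (B (i₀ ℤ.+ ℤ.+ 2)))
        ≡⟨ cong (cross (B i₀)) (trans (cong (_⊕ _) (scale-zero (B i₀))) (vec-≡ (+-identityˡ _) (+-identityˡ _) (+-identityˡ _))) ⟩
      cross (B i₀) (scale t (B (i₀ ℤ.+ ℤ.+ 2)))             ≡⟨ cong (cross (B i₀)) tB≡ ⟩
      cross (B i₀) (scale r (B i₀) ⊕ scale a C)             ≡⟨ cross-combinationʳ r a (B i₀) C ⟩
      scale a L                                             ≡⟨ cong (scale a) L≡0 ⟩
      scale a zero3                                         ≡⟨ scale-zero3 a ⟩
      zero3                                                 ∎))

    base : ∀ i → i ≡ i₀ → Incident L (B i)
    base i refl = dot-crossˡ (B i₀) C

    transfer : ∀ i → ∃ λ t → t ≢ 0# × t * dot L (B (i ℤ.+ ℤ.+ 2)) ≡ r * dot L (B i)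
    transfer i = let (t , a , t≢0 , tB≡) = next i in t , t≢0 , (begin
      t * dot L (B (i ℤ.+ ℤ.+ 2))          ≡⟨ dot-scale t L _ ⟨
      dot L (scale t (B (i ℤ.+ ℤ.+ 2)))    ≡⟨ cong (dot L) tB≡ ⟩
      dot L (scale r (B i) ⊕ scale a C)    ≡⟨ dot-linear r a L (B i) C ⟩
      r * dot L (B i) + a * dot L C        ≡⟨ cong (λ z → r * dot L (B i) + a * z) (dot-crossʳ (B i₀) C) ⟩
      r * dot L (B i) + a * 0#             ≡⟨ cong (r * dot L (B i) +_) (zeroʳ a) ⟩
      r * dot L (B i) + 0#                 ≡⟨ +-identityʳ _ ⟩
      r * dot L (B i)                      ∎)

    index : ∀ m → i₀ ℤ.+ ℤ.+ 2 ℤ.* m ℤ.+ ℤ.+ 2 ≡ i₀ ℤ.+ ℤ.+ 2 ℤ.* ℤ.suc m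
    index m = ℤsolve 2 (λ i m → i ℤ:+ ℤcon (ℤ.+ 2) ℤ:* m ℤ:+ ℤcon (ℤ.+ 2)
                            ℤ:= i ℤ:+ ℤcon (ℤ.+ 2) ℤ:* (ℤcon ℤ.1ℤ ℤ:+ m)) refl i₀ m

    up : ∀ m → Q m → Q (ℤ.suc m)
    up m on = let (t , t≢0 , eq) = transfer (i₀ ℤ.+ ℤ.+ 2 ℤ.* m) in
      subst (λ i → Incident L (B i)) (index m) (cancel-*ˡ t≢0 (trans eq (trans (cong (r *_) on) (zeroʳ r))))

    down : ∀ m → Q (ℤ.suc m) → Q m
    down m on = let (t , t≢0 , eq) = transfer (i₀ ℤ.+ ℤ.+ 2 ℤ.* m) in
      cancel-*ˡ r≢0 (trans (sym eq) (trans (cong (t *_) (subst (λ i → Incident L (B i)) (sym (index m)) on)) (zeroʳ t)))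

  -- The determinant equals - v · (u × w). This turns genericity into the distinctness of vertices
  -- two apart.
  noncollinear⇒distinct : ∀ u v w → det3 u v w ≢ 0# → NonZero3 (cross u w)
  noncollinear⇒distinct u@(vec a b c) v@(vec d e f) w@(vec g h i) det≢0 uw≡0 = det≢0 (begin
    det3 u v w
      ≡⟨ solve 9 (λ a b c d e f g h i →
           a :* (e :* i :- f :* h) :+ b :* (f :* g :- d :* i) :+ c :* (d :* h :- e :* g)
           := :- (d :* (b :* i :- c :* h) :+ e :* (c :* g :- a :* i) :+ f :* (a :* h :- b :* g))) refl a b c d e f g h i ⟩
    - dot v (cross u w)
      ≡⟨ cong (λ x → - dot v x) uw≡0 ⟩
    - dot v zero3
      ≡⟨ solve 3 (λ d e f → :- (d :* :0 :+ e :* :0 :+ f :* :0) := :0) refl d e f ⟩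
    0# ∎)
    where open ≡-Reasoning

open import Data.Nat using (_∸_; _≤_)
open import Data.Integer using (_+_; _*_; +_)

theorem7p9 : (R : RealField) → let open Geometry R in
    (n : ℕ) → 1 ≤ n →
    (M : Mat3) → IsProjectiveTransformation M → FixesInfinity M →
    (A : ℤ → R2) → AxisAligned A → Twisted n M A →
    DefinedUpTo (n ∸ 1) (λ i → lift (A i)) →
    NoThreeConsecutiveCollinear (iterT (n ∸ 1) (λ i → lift (A i))) →
    (i₀ : ℤ) → ∃ λ L → NonZero3 L ×
    (∀ m → Incident L (iterT (n ∸ 1) (λ i → lift (A i)) (i₀ + (+ 2) * m)))
-- With the half period written `suc n`, the iterate has level `n`, and each of its vertices has
-- `suc n` coefficients, one per index of its parity in a period.
theorem7p9 R (suc n) _ M det≢0 fixes A aligned twisted defined generic =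
  orbit-collinear B r≢0 next (λ i → noncollinear⇒distinct (B i) (B (i + + 1)) (B (i + + 2)) (generic i))
  where
  open Geometry R
  open Field R using (Carrier; 0#)
  open Vectors R
  open Collinearity R
  open AxisAlignedPolygon R A aligned
  open Iteration R P δ slide using (Vertex)
  B = iterT n P
  dilation = Homothety.homothety R {M} det≢0 fixes {A} {suc n} twisted
  r = proj₁ dilation
  C = proj₁ (proj₂ dilation)
  r≢0 = proj₁ (proj₂ (proj₂ dilation))
  open Periodic r r≢0 C n (proj₂ (proj₂ (proj₂ dilation)))

  vertex : ∀ s i → s + + n ≡ i → Vertex n s (B i)
  vertex s i refl = vertices n defined s

  next : ∀ i → ∃ λ t → ∃ λ a → t ≢ 0# × scale t (B (i + + 2)) ≡ scale r (B i) ⊕ scale a C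
  next i = next-vertex
    -- The base is `i - n`, because a vertex based at `s` has index `s + n` at level `n`.
    (vertex (i ℤ.- + n) i (ℤsolve 2 (λ i n → i ℤ:- n ℤ:+ n ℤ:= i) refl i (+ n)))
    (vertex _ (i + + 2) (ℤsolve 2 (λ i n → ℤcon ℤ.1ℤ ℤ:+ (ℤcon ℤ.1ℤ ℤ:+ (i ℤ:- n)) ℤ:+ n ℤ:= i ℤ:+ ℤcon (+ 2)) refl i (+ n)))
    (defined n ℕₚ.≤-refl i)
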